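{- Let $p>3$ be a prime and let \[f(X) = X + \sum_{i=1}^{\infty} a_i X^{i+3} \in \mathbb{F}_p[[X]], \qquad a_i \in \mathbb{F}_p,\] be an element of infinite order in the Nottingham group $\mathcal{N}(\mathbb{F}_p)$, i.e. $f^{\circ m}(X) \neq X$ for all $m \geq 1$. Then $i_n(f) = 3(1 + p + \dots + p^n)$ for all $n \geq 0$ if and only if $a_1 \neq 0$ and \[2a_1^4 - a_2^3 + 2a_1a_2a_3 - a_1^2a_4 \neq 0 \quad \text{in } \mathbb{F}_p.\]
   Context: $\mathcal{N}(\mathbb{F}_p)$ denotes the group, under composition, of formal power series $X + \sum_{i \geq 2} c_i X^i$ with coefficients $c_i \in \mathbb{F}_p$. $f^{\circ m}$ denotes the $m$-fold compositional iterate of $f$. For a nonzero $g \in \mathbb{F}_p((X))$, $\mathrm{val}_X(g)$ is the integer $i$ with $g \in X^i\mathbb{F}_p[[X]] \setminus X^{i+1}\mathbb{F}_p[[X]]$ (and $\mathrm{val}_X(0)=+\infty$). The ramification number of $g$ is $i(g) = \mathrm{val}_X(g(X) - X) - 1$, and the $n$-th ramification number is $i_n(g) = i(g^{\circ p^n})$. -}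

module Defs where

open import Data.Nat using (ℕ; zero; suc; _+_; _*_; _∸_; _^_; _<_)
open import Data.List using (upTo; map)
open import Data.Nat.ListAction using (sum)
open import Data.Product using (_×_)
open import Data.Empty using (⊥)
open import Data.Product using (∃-syntax)
open import Relation.Binary.PropositionalEquality using (_≡_)

-- Elements of 𝔽_p are represented by natural numbers, compared modulo p.
-- Congruence modulo p:  a ≡ b (mod p).
ModEq : ℕ → ℕ → ℕ → Set
ModEq p a b = ∃[ x ] ∃[ y ] (a + x * p ≡ b + y * p)

-- Formal power series: n ↦ coefficient of X^n (representatives in ℕ).
Series : Set
Series = ℕ → ℕ

sumTo : ℕ → (ℕ → ℕ) → ℕ
sumTo n h = sum (map h (upTo (suc n)))

oneS : Series
oneS zero    = 1
oneS (suc _) = 0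

idX : Series
idX (suc zero) = 1
idX _          = 0

mulS : Series → Series → Series
mulS f g n = sumTo n (λ i → f i * g (n ∸ i))

powS : Series → ℕ → Series
powS g zero    = oneS
powS g (suc k) = mulS g (powS g k)

-- composition f(g(X)), for g with zero constant term:
-- coefficient of X^n is Σ_{k=0}^{n} f_k · [X^n] g^k
compS : Series → Series → Series
compS f g n = sumTo n (λ k → f k * powS g k n)

iter : Series → ℕ → Series
iter f zero    = idX
iter f (suc m) = compS f (iter f m)

-- f(X) = X + Σ_{i ≥ 1} a_i X^{i+3}   (a 0 is ignored)
fOf : (ℕ → ℕ) → Series
fOf a zero                      = 0
fOf a (suc zero)                = 1
fOf a (suc (suc zero))          = 0
fOf a (suc (suc (suc zero)))    = 0
fOf a (suc (suc (suc (suc k)))) = a (suc k)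

SeriesEq : ℕ → Series → Series → Set
SeriesEq p f g = ∀ k → ModEq p (f k) (g k)

-- ramification number: RamNum p g r  ⇔  val_X(g(X) - X) = r + 1, i.e. i(g) = r
RamNum : ℕ → Series → ℕ → Set
RamNum p g r = (∀ k → k < suc r → ModEq p (g k) (idX k))
             × (ModEq p (g (suc r)) (idX (suc r)) → ⊥)

geomSum : ℕ → ℕ → ℕ
geomSum p zero    = 1
geomSum p (suc n) = geomSum p n + p ^ suc n

{-# OPTIONS --safe #-}

-- Write T h = h ∘ g and Δ = T − 1. In characteristic p, h ∘ g^{∘p} − h = Δ^p h, and Δ raises orders by
-- r = i(g), acting on the first four coefficients of h in terms of the first four coefficients of
-- g(X) − X. For r ≡ 3 (mod p), start from a suitable y of order k = r (p − 1) ≡ −3: modulo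
-- the next powers of X, Δ y has only the coefficients of X^{k+r} and X^{k+r+3}. The first dies under the
-- next Δ since k + r ≡ 0, the second is 6 times an invariant of g and gets multiplied by units, so
-- i(g^{∘p}) = r p + 3 exactly when the invariant is nonzero. For g = f this is the expression in the
-- theorem. For g = f^{∘p^n} with n ≥ 1 it is a unit times that expression: f and g commute, hence
-- Δ_f (g − X) = Δ_g (f − X), and comparing four coefficients determines those of g from those of f.

module Submission where

open import Defs
open import Data.Nat using (ℕ; zero; suc; pred; _+_; _*_; _^_; _∸_; _≤_; _<_; _≥_; z≤n; s≤s; s≤s⁻¹; NonZero)
open import Data.Nat.Properties
open import Data.Nat.Combinatorics using (_C_; nCk+nC[k+1]≡[n+1]C[k+1]; nC1≡n; nCn≡1; k>n⇒nCk≡0)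
open import Data.Nat.Divisibility using (_∣_; divides; ∣m+n∣m⇒∣n; m∣m*n; n∣m*n; ∣⇒≤)
open import Data.Nat.Primality using (Prime; euclidsLemma; prime⇒nonZero)
open import Data.Nat.Tactic.RingSolver using (solve-∀)
open import Data.Nat.ListAction using (sum)
open import Data.List using (applyUpTo)
open import Data.List.Properties using (map-upTo)
open import Data.Product using (_×_; _,_)
open import Data.Sum using (inj₁; inj₂)
open import Data.Empty using (⊥-elim)
open import Function using (_∘_)
open import Function.Bundles using (_⇔_; mk⇔)
open import Level using (0ℓ)
open import Relation.Binary.Bundles using (Setoid)
open import Relation.Binary.PropositionalEquality
  using (_≡_; refl; sym; trans; cong; cong₂; subst; subst₂; module ≡-Reasoning)
open import Relation.Nullary using (¬_)
import Relation.Binary.Reasoning.Setoid as SetoidReasoning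

-- For y of order k, the leading coefficient of Δ^p y carries the product of all k + i r with i < p.
-- As r ≡ 3 is a unit, one of these factors is 0 for every k, so the leading term never decides and
-- the three coefficients behind it have to be followed. With y = X the zero factor would come at a
-- step that depends on p. With k ≡ -r it comes at the second step, and the coefficient three places
-- further on then sits at exponents ≡ 3, 6, ..., 3(p - 1), all units. The square of v = g(X)/X - 1
-- reaches these four coefficients only if r = 3. It produces the term 2a₁⁴ for f and is absent for
-- the later iterates; there the same term returns through the relation between c₃ and a₄ that
-- commutation forces. Coefficients are natural numbers, so identities are stated with negative
-- terms moved to the other side, and an invariant P - Q ≠ 0 becomes P ≉ Q.

-- Finite sums and Cauchy products over ℕ.

tail : Series → Series
tail f = f ∘ suc

∑ : ℕ → (ℕ → ℕ) → ℕ
∑ n h = sum (applyUpTo h n)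

sumTo≡∑ : ∀ n h → sumTo n h ≡ ∑ (suc n) h
sumTo≡∑ n h = cong sum (map-upTo h (suc n))

∑-cong : ∀ n {g h : ℕ → ℕ} → (∀ i → i < n → g i ≡ h i) → ∑ n g ≡ ∑ n h
∑-cong zero    e = refl
∑-cong (suc n) e = cong₂ _+_ (e 0 (s≤s z≤n)) (∑-cong n λ i i<n → e (suc i) (s≤s i<n))

∑-+ : ∀ n g h → ∑ n (λ i → g i + h i) ≡ ∑ n g + ∑ n h
∑-+ zero    g h = refl
∑-+ (suc n) g h rewrite ∑-+ n (g ∘ suc) (h ∘ suc) = swap (g 0) (h 0) (∑ n (g ∘ suc)) (∑ n (h ∘ suc))
  where swap : ∀ a b c d → a + b + (c + d) ≡ a + c + (b + d)
        swap = solve-∀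

∑-split : ∀ m n h → ∑ (m + n) h ≡ ∑ m h + ∑ n (λ i → h (m + i))
∑-split zero    n h = refl
∑-split (suc m) n h = trans (cong (h 0 +_) (∑-split m n (h ∘ suc))) (sym (+-assoc (h 0) _ _))

∑-last : ∀ n h → ∑ (suc n) h ≡ ∑ n h + h n
∑-last zero    h = +-comm (h 0) 0
∑-last (suc n) h = trans (cong (h 0 +_) (∑-last n (h ∘ suc))) (sym (+-assoc (h 0) _ _))

shift : ℕ → Series → Series
shift zero    h         = h
shift (suc k) h zero    = 0
shift (suc k) h (suc n) = shift k h n

shift-low : ∀ k h n → n < k → shift k h n ≡ 0
shift-low (suc k) h zero    _         = refl
shift-low (suc k) h (suc n) (s≤s n<k) = shift-low k h n n<k

shift-at : ∀ k h n → shift k h (k + n) ≡ h n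
shift-at zero    h n = refl
shift-at (suc k) h n = shift-at k h n

mul-zero : ∀ f g → mulS f g 0 ≡ f 0 * g 0
mul-zero f g = +-identityʳ _

mul-suc : ∀ f g n → mulS f g (suc n) ≡ f 0 * g (suc n) + mulS (tail f) g n
mul-suc f g n = trans (sumTo≡∑ (suc n) (λ i → f i * g (suc n ∸ i)))
  (cong (f 0 * g (suc n) +_) (sym (sumTo≡∑ n (λ i → f (suc i) * g (n ∸ i)))))

mul-+ʳ : ∀ f g h n → mulS f (λ k → g k + h k) n ≡ mulS f g n + mulS f h n
mul-+ʳ f g h zero = trans (mul-zero f (λ k → g k + h k)) (trans (*-distribˡ-+ (f 0) (g 0) (h 0))
  (sym (cong₂ _+_ (mul-zero f g) (mul-zero f h))))
mul-+ʳ f g h (suc n)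
  rewrite mul-suc f (λ k → g k + h k) n | mul-suc f g n | mul-suc f h n | mul-+ʳ (tail f) g h n
  = lem (f 0) (g (suc n)) (h (suc n)) (mulS (tail f) g n) (mulS (tail f) h n)
  where lem : ∀ a b c d e → a * (b + c) + (d + e) ≡ a * b + d + (a * c + e)
        lem = solve-∀

mul-*ʳ : ∀ f c g n → mulS f (λ k → c * g k) n ≡ c * mulS f g n
mul-*ʳ f c g zero = trans (mul-zero f (λ k → c * g k)) (trans (lem (f 0) c (g 0)) (cong (c *_) (sym (mul-zero f g))))
  where lem : ∀ a b d → a * (b * d) ≡ b * (a * d)
        lem = solve-∀
mul-*ʳ f c g (suc n)
  rewrite mul-suc f (λ k → c * g k) n | mul-suc f g n | mul-*ʳ (tail f) c g n
  = lem (f 0) c (g (suc n)) (mulS (tail f) g n)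
  where lem : ∀ a b d e → a * (b * d) + b * e ≡ b * (a * d + e)
        lem = solve-∀

mul-+ˡ : ∀ f g h n → mulS (λ k → f k + g k) h n ≡ mulS f h n + mulS g h n
mul-+ˡ f g h zero = trans (mul-zero (λ k → f k + g k) h) (trans (*-distribʳ-+ (h 0) (f 0) (g 0))
  (sym (cong₂ _+_ (mul-zero f h) (mul-zero g h))))
mul-+ˡ f g h (suc n)
  rewrite mul-suc (λ k → f k + g k) h n | mul-suc f h n | mul-suc g h n | mul-+ˡ (tail f) (tail g) h n
  = lem (f 0) (g 0) (h (suc n)) (mulS (tail f) h n) (mulS (tail g) h n)
  where lem : ∀ a b c d e → (a + b) * c + (d + e) ≡ a * c + d + (b * c + e)
        lem = solve-∀

mul-*ˡ : ∀ c f g n → mulS (λ k → c * f k) g n ≡ c * mulS f g n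
mul-*ˡ c f g zero = trans (mul-zero (λ k → c * f k) g) (trans (*-assoc c (f 0) (g 0)) (cong (c *_) (sym (mul-zero f g))))
mul-*ˡ c f g (suc n)
  rewrite mul-suc (λ k → c * f k) g n | mul-suc f g n | mul-*ˡ c (tail f) g n
  = lem c (f 0) (g (suc n)) (mulS (tail f) g n)
  where lem : ∀ a b d e → a * b * d + a * e ≡ a * (b * d + e)
        lem = solve-∀

mul-zeroˡ : ∀ g n → mulS (λ _ → 0) g n ≡ 0
mul-zeroˡ g zero    = refl
mul-zeroˡ g (suc n) = trans (mul-suc (λ _ → 0) g n) (mul-zeroˡ g n)

mul-oneˡ : ∀ g n → mulS oneS g n ≡ g n
mul-oneˡ g zero    = trans (mul-zero oneS g) (*-identityˡ _)
mul-oneˡ g (suc n) = trans (mul-suc oneS g n)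
  (trans (cong₂ _+_ (*-identityˡ (g (suc n))) (mul-zeroˡ g n)) (+-identityʳ _))

mul-oneʳ : ∀ f n → mulS f oneS n ≡ f n
mul-oneʳ f zero    = trans (mul-zero f oneS) (*-identityʳ _)
mul-oneʳ f (suc n) = trans (mul-suc f oneS n) (cong₂ _+_ (*-zeroʳ (f 0)) (mul-oneʳ (tail f) n))

-- Binomial coefficients.

pascal : ∀ n k → suc n C suc k ≡ n C k + n C suc k
pascal n k = sym (nCk+nC[k+1]≡[n+1]C[k+1] n k)

-- Division-free form of C(n+1, k+1) = (n+1)/(k+1) · C(n, k), by Pascal's rule on both sides.
absorption : ∀ n k → suc k * (suc n C suc k) ≡ suc n * (n C k)
absorption zero zero = refl
absorption zero (suc k) = trans (cong (suc (suc k) *_) (k>n⇒nCk≡0 {1} {suc (suc k)} (s≤s (s≤s z≤n))))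
  (trans (*-zeroʳ k) (sym (cong (1 *_) (k>n⇒nCk≡0 {0} {suc k} (s≤s z≤n)))))
absorption (suc n) zero = trans (*-identityˡ _) (trans (nC1≡n (suc (suc n))) (sym (*-identityʳ _)))
absorption (suc n) (suc k) = begin
  suc (suc k) * (suc (suc n) C suc (suc k))
    ≡⟨ cong (suc (suc k) *_) (pascal (suc n) (suc k)) ⟩
  suc (suc k) * (A + B)                           ≡⟨ lem₁ (suc k) A B ⟩
  A + (suc k * A + suc (suc k) * B)
    ≡⟨ cong (A +_) (cong₂ _+_ (absorption n k) (absorption n (suc k))) ⟩
  A + (suc n * (n C k) + suc n * (n C suc k))     ≡⟨ cong (A +_) (sym (*-distribˡ-+ (suc n) (n C k) _)) ⟩
  A + suc n * (n C k + n C suc k)                 ≡⟨ cong (λ x → A + suc n * x) (sym (pascal n k)) ⟩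
  suc (suc n) * A ∎
  where
  open ≡-Reasoning
  A = suc n C suc k
  B = suc n C suc (suc k)
  lem₁ : ∀ k a b → suc k * (a + b) ≡ a + (k * a + suc k * b)
  lem₁ = solve-∀

2*nC2+n≡n*n : ∀ n → 2 * (n C 2) + n ≡ n * n
2*nC2+n≡n*n zero    = refl
2*nC2+n≡n*n (suc n) = begin
  2 * (suc n C 2) + suc n              ≡⟨ cong (λ z → 2 * z + suc n) (trans (pascal n 1) (cong (_+ (n C 2)) (nC1≡n n))) ⟩
  2 * (n + (n C 2)) + suc n            ≡⟨ lem₁ n (n C 2) ⟩
  2 * (n C 2) + n + suc (n + n)        ≡⟨ cong (_+ suc (n + n)) (2*nC2+n≡n*n n) ⟩
  n * n + suc (n + n)                  ≡⟨ lem₂ n ⟩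
  suc n * suc n                        ∎
  where
  open ≡-Reasoning
  lem₁ : ∀ n t → 2 * (n + t) + suc n ≡ 2 * t + n + suc (n + n)
  lem₁ = solve-∀
  lem₂ : ∀ n → n * n + suc (n + n) ≡ suc n * suc n
  lem₂ = solve-∀

-- By `absorption`, p divides k · C(p, k), and p cannot divide k since 0 < k < p.
prime∣binomial : ∀ {p} → Prime p → ∀ k → 0 < k → k < p → p ∣ p C k
prime∣binomial {suc n} pp (suc k) _ k<p with euclidsLemma (suc k) (suc n C suc k) pp
    (subst (suc n ∣_) (sym (absorption n k)) (m∣m*n (n C k)))
... | inj₁ d = ⊥-elim (<⇒≱ k<p (∣⇒≤ d))
... | inj₂ d = d

-- Arithmetic modulo p.

module Modulo (p : ℕ) .{{p≢0 : NonZero p}} where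

  infix 4 _≈_ _≉_

  -- Wrapped in a record so that `a` and `b` can be inferred from a proof; they are lost once
  -- `ModEq` unfolds.
  record _≈_ (a b : ℕ) : Set where
    constructor mod
    field unmod : ModEq p a b
  open _≈_ public

  _≉_ : ℕ → ℕ → Set
  a ≉ b = ¬ a ≈ b

  ≡⇒≈ : ∀ {a b} → a ≡ b → a ≈ b
  ≡⇒≈ {a} refl = mod (0 , 0 , refl)

  ≈-refl : ∀ {a} → a ≈ a
  ≈-refl = ≡⇒≈ refl

  ≈-sym : ∀ {a b} → a ≈ b → b ≈ a
  ≈-sym (mod (x , y , e)) = mod (y , x , sym e)

  ≈-trans : ∀ {a b c} → a ≈ b → b ≈ c → a ≈ c
  ≈-trans {a} {b} {c} (mod (x , y , e)) (mod (x' , y' , e')) = mod (x + x' , y + y' , (begin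
    a + (x + x') * p       ≡⟨ lem₁ a x x' p ⟩
    a + x * p + x' * p     ≡⟨ cong (_+ x' * p) e ⟩
    b + y * p + x' * p     ≡⟨ lem₂ b y x' p ⟩
    b + x' * p + y * p     ≡⟨ cong (_+ y * p) e' ⟩
    c + y' * p + y * p     ≡⟨ lem₃ c y' y p ⟩
    c + (y + y') * p       ∎))
    where
    open ≡-Reasoning
    lem₁ : ∀ a x y p → a + (x + y) * p ≡ a + x * p + y * p
    lem₁ = solve-∀
    lem₂ : ∀ a x y p → a + x * p + y * p ≡ a + y * p + x * p
    lem₂ = solve-∀
    lem₃ : ∀ a x y p → a + x * p + y * p ≡ a + (y + x) * p
    lem₃ = solve-∀

  ≈-setoid : Setoid 0ℓ 0ℓ
  ≈-setoid = record { _≈_ = _≈_ ; isEquivalence = record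
    { refl = ≈-refl ; sym = ≈-sym ; trans = ≈-trans } }

  module ≈-Reasoning = SetoidReasoning ≈-setoid

  +-cong : ∀ {a b c d} → a ≈ b → c ≈ d → a + c ≈ b + d
  +-cong {a} {b} {c} {d} (mod (x , y , e)) (mod (x' , y' , e')) = mod (x + x' , y + y' ,
    trans (lem a c x x' p) (trans (cong₂ _+_ e e') (sym (lem b d y y' p))))
    where lem : ∀ a c x y p → a + c + (x + y) * p ≡ a + x * p + (c + y * p)
          lem = solve-∀

  +-congˡ : ∀ c {a b} → a ≈ b → c + a ≈ c + b
  +-congˡ c = +-cong ≈-refl

  +-congʳ : ∀ c {a b} → a ≈ b → a + c ≈ b + c
  +-congʳ c e = +-cong e ≈-refl

  *-congˡ : ∀ c {a b} → a ≈ b → c * a ≈ c * b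
  *-congˡ c {a} {b} (mod (x , y , e)) = mod (c * x , c * y ,
    trans (lem c a x p) (trans (cong (c *_) e) (sym (lem c b y p))))
    where lem : ∀ c a x p → c * a + c * x * p ≡ c * (a + x * p)
          lem = solve-∀

  *-congʳ : ∀ c {a b} → a ≈ b → a * c ≈ b * c
  *-congʳ c {a} {b} e = ≈-trans (≡⇒≈ (*-comm a c)) (≈-trans (*-congˡ c e) (≡⇒≈ (*-comm c b)))

  *-cong : ∀ {a b c d} → a ≈ b → c ≈ d → a * c ≈ b * d
  *-cong {b = b} {c = c} e e' = ≈-trans (*-congʳ c e) (*-congˡ b e')

  +-cancelˡ : ∀ c {a b} → c + a ≈ c + b → a ≈ b
  +-cancelˡ c {a} {b} (mod (x , y , e)) = mod (x , y ,
    +-cancelˡ-≡ c _ _ (trans (sym (+-assoc c a _)) (trans e (+-assoc c b _))))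

  +-cancelʳ : ∀ c {a b} → a + c ≈ b + c → a ≈ b
  +-cancelʳ c {a} {b} e = +-cancelˡ c (≈-trans (≡⇒≈ (+-comm c a)) (≈-trans e (≡⇒≈ (+-comm b c))))

  p*≈0 : ∀ c → p * c ≈ 0
  p*≈0 c = mod (0 , c , trans (+-identityʳ _) (*-comm p c))

  ∣⇒≈0 : ∀ {a} → p ∣ a → a ≈ 0
  ∣⇒≈0 (divides q refl) = ≈-trans (≡⇒≈ (*-comm q p)) (p*≈0 q)

  ≈0⇒∣ : ∀ {a} → a ≈ 0 → p ∣ a
  ≈0⇒∣ {a} (mod (x , y , e)) = ∣m+n∣m⇒∣n (divides y (trans (+-comm (x * p) a) e)) (n∣m*n x)

  neg : ℕ → ℕ
  neg a = pred p * a

  neg-inverse : ∀ a → a + neg a ≈ 0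
  neg-inverse a = ≈-trans (≡⇒≈ (cong (_* a) (suc-pred p))) (p*≈0 a)

  *-≈0ˡ : ∀ {a} b → a ≈ 0 → a * b ≈ 0
  *-≈0ˡ b e = *-congʳ b e

  *-≈0ʳ : ∀ a {b} → b ≈ 0 → a * b ≈ 0
  *-≈0ʳ a e = ≈-trans (*-congˡ a e) (≡⇒≈ (*-zeroʳ a))

  +-≈0 : ∀ {a b} → a ≈ 0 → b ≈ 0 → a + b ≈ 0
  +-≈0 = +-cong

  ∑-≈ : ∀ n {g h : ℕ → ℕ} → (∀ i → i < n → g i ≈ h i) → ∑ n g ≈ ∑ n h
  ∑-≈ zero    e = ≈-refl
  ∑-≈ (suc n) e = +-cong (e 0 (s≤s z≤n)) (∑-≈ n λ i i<n → e (suc i) (s≤s i<n))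

  ∑-≈0 : ∀ n {h : ℕ → ℕ} → (∀ i → i < n → h i ≈ 0) → ∑ n h ≈ 0
  ∑-≈0 zero    e = ≈-refl
  ∑-≈0 (suc n) e = +-≈0 (e 0 (s≤s z≤n)) (∑-≈0 n λ i i<n → e (suc i) (s≤s i<n))

  -- Cauchy products modulo p.

  mul-cong : ∀ n f f' g g' → (∀ k → k ≤ n → f k ≈ f' k) → (∀ k → k ≤ n → g k ≈ g' k)
    → mulS f g n ≈ mulS f' g' n
  mul-cong zero f f' g g' ef eg = ≈-trans (≡⇒≈ (mul-zero f g))
    (≈-trans (*-cong (ef 0 z≤n) (eg 0 z≤n)) (≡⇒≈ (sym (mul-zero f' g'))))
  mul-cong (suc n) f f' g g' ef eg = ≈-trans (≡⇒≈ (mul-suc f g n))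
    (≈-trans (+-cong (*-cong (ef 0 z≤n) (eg (suc n) ≤-refl))
       (mul-cong n (tail f) (tail f') g g' (λ k k≤n → ef (suc k) (s≤s k≤n)) (λ k k≤n → eg k (m≤n⇒m≤1+n k≤n))))
    (≡⇒≈ (sym (mul-suc f' g' n))))

  mul-congˡ : ∀ n f g g' → (∀ k → k ≤ n → g k ≈ g' k) → mulS f g n ≈ mulS f g' n
  mul-congˡ n f g g' = mul-cong n f f g g' (λ _ _ → ≈-refl)

  mul-congʳ : ∀ n f f' g → (∀ k → k ≤ n → f k ≈ f' k) → mulS f g n ≈ mulS f' g n
  mul-congʳ n f f' g e = mul-cong n f f' g g e (λ _ _ → ≈-refl)

  -- Splitting off the constant term of f: tail (f g) = f₀ · tail g + tail f · g.
  mul-assoc : ∀ f g h n → mulS (mulS f g) h n ≈ mulS f (mulS g h) n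
  mul-assoc f g h zero = ≡⇒≈ (trans (mul-zero (mulS f g) h) (trans (cong (_* h 0) (mul-zero f g))
    (trans (*-assoc (f 0) (g 0) (h 0)) (sym (trans (mul-zero f (mulS g h)) (cong (f 0 *_) (mul-zero g h)))))))
  mul-assoc f g h (suc n) = begin
    mulS (mulS f g) h (suc n)
      ≡⟨ mul-suc (mulS f g) h n ⟩
    mulS f g 0 * h (suc n) + mulS (tail (mulS f g)) h n
      ≈⟨ +-cong (≡⇒≈ (cong (_* h (suc n)) (mul-zero f g)))
          (mul-congʳ n _ (λ k → f 0 * g (suc k) + mulS (tail f) g k) h (λ k _ → ≡⇒≈ (mul-suc f g k))) ⟩
    f 0 * g 0 * h (suc n) + mulS (λ k → f 0 * g (suc k) + mulS (tail f) g k) h n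
      ≡⟨ cong (f 0 * g 0 * h (suc n) +_) (trans (mul-+ˡ (λ k → f 0 * g (suc k)) (mulS (tail f) g) h n)
          (cong (_+ mulS (mulS (tail f) g) h n) (mul-*ˡ (f 0) (tail g) h n))) ⟩
    f 0 * g 0 * h (suc n) + (f 0 * mulS (tail g) h n + mulS (mulS (tail f) g) h n)
      ≡⟨ lem (f 0) (g 0) (h (suc n)) _ _ ⟩
    f 0 * (g 0 * h (suc n) + mulS (tail g) h n) + mulS (mulS (tail f) g) h n
      ≈⟨ +-cong (≡⇒≈ (cong (f 0 *_) (sym (mul-suc g h n)))) (mul-assoc (tail f) g h n) ⟩
    f 0 * mulS g h (suc n) + mulS (tail f) (mulS g h) n
      ≡⟨ mul-suc f (mulS g h) n ⟨
    mulS f (mulS g h) (suc n) ∎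
    where
    open ≈-Reasoning
    lem : ∀ a b c d e → a * b * c + (a * d + e) ≡ a * (b * c + d) + e
    lem = solve-∀

  mul-tailˡ : ∀ f g n → f 0 ≈ 0 → mulS f g (suc n) ≈ mulS (tail f) g n
  mul-tailˡ f g n e = ≈-trans (≡⇒≈ (mul-suc f g n)) (+-congʳ (mulS (tail f) g n) (*-≈0ˡ (g (suc n)) e))

  mul-≈0ʳ : ∀ f g n → (∀ k → k ≤ n → g k ≈ 0) → mulS f g n ≈ 0
  mul-≈0ʳ f g zero e = ≈-trans (≡⇒≈ (mul-zero f g)) (*-≈0ʳ (f 0) (e 0 z≤n))
  mul-≈0ʳ f g (suc n) e = ≈-trans (≡⇒≈ (mul-suc f g n))
    (+-≈0 (*-≈0ʳ (f 0) (e (suc n) ≤-refl)) (mul-≈0ʳ (tail f) g n (λ k k≤n → e k (m≤n⇒m≤1+n k≤n))))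

  mul-shiftʳ : ∀ f g k n → (∀ i → i < k → g i ≈ 0) → mulS f g (k + n) ≈ mulS f (λ i → g (k + i)) n
  mul-shiftʳ f g zero    n e = ≈-refl
  mul-shiftʳ f g (suc k) zero e = ≈-trans (≡⇒≈ (mul-suc f g (k + 0)))
    (≈-trans (+-congˡ (f 0 * g (suc (k + 0))) (mul-≈0ʳ (tail f) g (k + 0)
        (λ i i≤ → e i (s≤s (subst (i ≤_) (+-identityʳ k) i≤)))))
      (≡⇒≈ refl))
  mul-shiftʳ f g (suc k) (suc n) e = ≈-trans (≡⇒≈ (mul-suc f g (k + suc n)))
    (≈-trans (+-congˡ (f 0 * g (suc (k + suc n)))
        (≈-trans (≡⇒≈ (cong (mulS (tail f) g) (+-suc k n))) (mul-shiftʳ (tail f) g (suc k) n e)))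
      (≡⇒≈ (sym (mul-suc f (λ i → g (suc k + i)) n))))

  mul-shiftˡ : ∀ f g k n → (∀ i → i < k → f i ≈ 0) → mulS f g (k + n) ≈ mulS (λ i → f (k + i)) g n
  mul-shiftˡ f g zero    n e = ≈-refl
  mul-shiftˡ f g (suc k) n e = ≈-trans (mul-tailˡ f g (k + n) (e 0 (s≤s z≤n)))
    (mul-shiftˡ (tail f) g k n (λ i i<k → e (suc i) (s≤s i<k)))

  -- Powers and composition of series.

  pow-cong : ∀ j n f f' → (∀ k → k ≤ n → f k ≈ f' k) → powS f j n ≈ powS f' j n
  pow-cong zero    n f f' e = ≈-refl
  pow-cong (suc j) n f f' e = mul-cong n f f' (powS f j) (powS f' j) e
    (λ k k≤n → pow-cong j k f f' (λ i i≤k → e i (≤-trans i≤k k≤n)))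

  pow-≈0 : ∀ g j n → g 0 ≈ 0 → n < j → powS g j n ≈ 0
  pow-≈0 g (suc j) zero    e _ = ≈-trans (≡⇒≈ (mul-zero g (powS g j))) (*-≈0ˡ (powS g j 0) e)
  pow-≈0 g (suc j) (suc n) e (s≤s n<j) = ≈-trans (mul-tailˡ g (powS g j) n e)
    (mul-≈0ʳ (tail g) (powS g j) n (λ k k≤n → pow-≈0 g j k e (≤-<-trans k≤n n<j)))

  -- g = X · tail g, hence g^j = X^j (tail g)^j.
  pow-tail : ∀ g j n → g 0 ≈ 0 → powS g j (j + n) ≈ powS (tail g) j n
  pow-tail g zero    n e = ≈-refl
  pow-tail g (suc j) n e = ≈-trans (mul-tailˡ g (powS g j) (j + n) e)
    (≈-trans (mul-shiftʳ (tail g) (powS g j) j n (λ i i<j → pow-≈0 g j i e i<j))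
      (mul-congˡ n (tail g) (λ i → powS g j (j + i)) (powS (tail g) j) (λ k _ → pow-tail g j k e)))

  comp≡∑ : ∀ f g n → compS f g n ≡ ∑ (suc n) (λ k → f k * powS g k n)
  comp≡∑ f g n = sumTo≡∑ n _

  comp-zero : ∀ f g → compS f g 0 ≡ f 0
  comp-zero f g = trans (+-identityʳ _) (*-identityʳ (f 0))

  mul-∑ : ∀ f N (c : ℕ → ℕ) (P : ℕ → Series) n
    → mulS f (λ m → ∑ N (λ k → c k * P k m)) n ≡ ∑ N (λ k → c k * mulS f (P k) n)
  mul-∑ f zero c P n = trans (mul-*ʳ f 0 (λ _ → 0) n) refl
  mul-∑ f (suc N) c P n = trans
    (mul-+ʳ f (λ m → c 0 * P 0 m) (λ m → ∑ N (λ k → c (suc k) * P (suc k) m)) n)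
    (cong₂ _+_ (mul-*ʳ f (c 0) (P 0) n) (mul-∑ f N (c ∘ suc) (P ∘ suc) n))

  -- The added terms vanish because g^k has order at least k. A bound common to all coefficients up
  -- to n is what permits exchanging a composition with a product.
  comp-extend : ∀ f g N n → g 0 ≈ 0 → n < N → ∑ N (λ k → f k * powS g k n) ≈ compS f g n
  comp-extend f g N n e n<N = begin
    ∑ N F                         ≡⟨ cong (λ z → ∑ z F) (m+[n∸m]≡n n<N) ⟨
    ∑ (suc n + (N ∸ suc n)) F     ≡⟨ ∑-split (suc n) (N ∸ suc n) F ⟩
    ∑ (suc n) F + ∑ (N ∸ suc n) (λ i → F (suc n + i))
      ≈⟨ +-congˡ (∑ (suc n) F) (∑-≈0 (N ∸ suc n) (λ i _ → *-≈0ʳ (f (suc n + i)) (pow-≈0 g (suc n + i) n e (s≤s (m≤m+n n i))))) ⟩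
    ∑ (suc n) F + 0               ≡⟨ +-identityʳ _ ⟩
    ∑ (suc n) F                   ≡⟨ comp≡∑ f g n ⟨
    compS f g n                   ∎
    where
    open ≈-Reasoning
    F : ℕ → ℕ
    F k = f k * powS g k n

  -- From f = f₀ + X · tail f follows f ∘ g = f₀ + g · (tail f ∘ g); then one factor X is divided
  -- out. The laws of composition below rest on this recursion.
  comp-suc : ∀ f g n → g 0 ≈ 0 → compS f g (suc n) ≈ mulS (tail g) (compS (tail f) g) n
  comp-suc f g n e = begin
    compS f g (suc n)
      ≡⟨ comp≡∑ f g (suc n) ⟩
    f 0 * 0 + ∑ (suc n) (λ k → f (suc k) * mulS g (powS g k) (suc n))
      ≡⟨ cong (_+ ∑ (suc n) (λ k → f (suc k) * mulS g (powS g k) (suc n))) (*-zeroʳ (f 0)) ⟩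
    ∑ (suc n) (λ k → f (suc k) * mulS g (powS g k) (suc n))
      ≈⟨ ∑-≈ (suc n) (λ k _ → *-congˡ (f (suc k)) (mul-tailˡ g (powS g k) n e)) ⟩
    ∑ (suc n) (λ k → f (suc k) * mulS (tail g) (powS g k) n)
      ≡⟨ mul-∑ (tail g) (suc n) (tail f) (powS g) n ⟨
    mulS (tail g) (λ m → ∑ (suc n) (λ k → f (suc k) * powS g k m)) n
      ≈⟨ mul-congˡ n (tail g) _ (compS (tail f) g)
          (λ k k≤n → comp-extend (tail f) g (suc n) k e (s≤s k≤n)) ⟩
    mulS (tail g) (compS (tail f) g) n ∎
    where open ≈-Reasoning

  comp-cong : ∀ n f f' g g' → (∀ k → k ≤ n → f k ≈ f' k) → (∀ k → k ≤ n → g k ≈ g' k)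
    → compS f g n ≈ compS f' g' n
  comp-cong n f f' g g' ef eg = ≈-trans (≡⇒≈ (comp≡∑ f g n)) (≈-trans
    (∑-≈ (suc n) (λ k k≤n → *-cong (ef k (s≤s⁻¹ k≤n)) (pow-cong k n g g' eg)))
    (≡⇒≈ (sym (comp≡∑ f' g' n))))

  comp-congˡ : ∀ n f g g' → (∀ k → g k ≈ g' k) → compS f g n ≈ compS f g' n
  comp-congˡ n f g g' e = comp-cong n f f g g' (λ _ _ → ≈-refl) (λ k _ → e k)

  comp-congʳ : ∀ n f f' g → (∀ k → k ≤ n → f k ≈ f' k) → compS f g n ≈ compS f' g n
  comp-congʳ n f f' g e = comp-cong n f f' g g e (λ _ _ → ≈-refl)

  comp-+ : ∀ f f' g n → compS (λ k → f k + f' k) g n ≡ compS f g n + compS f' g n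
  comp-+ f f' g n = trans (comp≡∑ (λ k → f k + f' k) g n) (trans
    (∑-cong (suc n) (λ k _ → *-distribʳ-+ (powS g k n) (f k) (f' k)))
    (trans (∑-+ (suc n) (λ k → f k * powS g k n) (λ k → f' k * powS g k n))
      (sym (cong₂ _+_ (comp≡∑ f g n) (comp≡∑ f' g n)))))

  comp-* : ∀ c f g n → compS (λ k → c * f k) g n ≡ c * compS f g n
  comp-* c f g n = begin
    compS (λ k → c * f k) g n                      ≡⟨ comp≡∑ (λ k → c * f k) g n ⟩
    ∑ (suc n) (λ k → c * f k * powS g k n)         ≡⟨ ∑-* (suc n) {f} {λ k → powS g k n} ⟩
    c * ∑ (suc n) (λ k → f k * powS g k n)         ≡⟨ cong (c *_) (comp≡∑ f g n) ⟨
    c * compS f g n                                ∎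
    where
    open ≡-Reasoning
    ∑-* : ∀ N {h h' : ℕ → ℕ} → ∑ N (λ k → c * h k * h' k) ≡ c * ∑ N (λ k → h k * h' k)
    ∑-* zero = sym (*-zeroʳ c)
    ∑-* (suc N) {h} {h'} = trans (cong₂ _+_ (*-assoc c (h 0) (h' 0)) (∑-* N {h ∘ suc} {h' ∘ suc}))
      (sym (*-distribˡ-+ c (h 0 * h' 0) _))

  -- Strong induction on the exponent, with `N` as its bound: after removing one factor X, the
  -- product rule is needed for `tail a` and `b` at every smaller exponent.
  comp-mul : ∀ g → g 0 ≈ 0 → ∀ N a b n → n < N
    → compS (mulS a b) g n ≈ mulS (compS a g) (compS b g) n
  comp-mul g e (suc N) a b zero _ = ≡⇒≈ (trans (comp-zero (mulS a b) g) (trans (mul-zero a b)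
    (trans (sym (cong₂ _*_ (comp-zero a g) (comp-zero b g))) (sym (mul-zero (compS a g) (compS b g))))))
  comp-mul g e (suc N) a b (suc n) (s≤s n<N) = begin
    compS (mulS a b) g (suc n)
      ≈⟨ comp-suc (mulS a b) g n e ⟩
    mulS g' (compS (tail (mulS a b)) g) n
      ≈⟨ mul-congˡ n g' _ (λ k → a 0 * compS (tail b) g k + mulS (compS (tail a) g) B k) tail-comp ⟩
    mulS g' (λ k → a 0 * compS (tail b) g k + mulS (compS (tail a) g) B k) n
      ≡⟨ trans (mul-+ʳ g' (λ k → a 0 * compS (tail b) g k) (mulS (compS (tail a) g) B) n)
          (cong (_+ mulS g' (mulS (compS (tail a) g) B) n) (mul-*ʳ g' (a 0) (compS (tail b) g) n)) ⟩
    a 0 * mulS g' (compS (tail b) g) n + mulS g' (mulS (compS (tail a) g) B) n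
      ≈⟨ +-cong (*-cong (≡⇒≈ (comp-zero a g)) (comp-suc b g n e)) (mul-assoc g' (compS (tail a) g) B n) ⟨
    A 0 * B (suc n) + mulS (mulS g' (compS (tail a) g)) B n
      ≈⟨ +-congˡ (A 0 * B (suc n)) (mul-congʳ n (tail A) _ B (λ k _ → comp-suc a g k e)) ⟨
    A 0 * B (suc n) + mulS (tail A) B n
      ≡⟨ mul-suc A B n ⟨
    mulS A B (suc n) ∎
    where
    open ≈-Reasoning
    g' A B : Series
    g' = tail g
    A = compS a g
    B = compS b g
    tail-comp : ∀ k → k ≤ n → compS (tail (mulS a b)) g k
      ≈ a 0 * compS (tail b) g k + mulS (compS (tail a) g) B k
    tail-comp k k≤n = begin
      compS (tail (mulS a b)) g k
        ≈⟨ comp-congʳ k _ (λ i → a 0 * b (suc i) + mulS (tail a) b i) g (λ i _ → ≡⇒≈ (mul-suc a b i)) ⟩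
      compS (λ i → a 0 * b (suc i) + mulS (tail a) b i) g k
        ≡⟨ trans (comp-+ (λ i → a 0 * b (suc i)) (mulS (tail a) b) g k)
            (cong (_+ compS (mulS (tail a) b) g k) (comp-* (a 0) (tail b) g k)) ⟩
      a 0 * compS (tail b) g k + compS (mulS (tail a) b) g k
        ≈⟨ +-congˡ (a 0 * compS (tail b) g k) (comp-mul g e N (tail a) b k (≤-<-trans k≤n n<N)) ⟩
      a 0 * compS (tail b) g k + mulS (compS (tail a) g) B k ∎

  -- Again strong induction bounded by `N`: tail (a ∘ g) = tail g · (tail a ∘ g), and `comp-mul`
  -- distributes h over this product.
  comp-assoc : ∀ g h → g 0 ≈ 0 → h 0 ≈ 0 → ∀ N a n → n < N
    → compS (compS a g) h n ≈ compS a (compS g h) n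
  comp-assoc g h eg eh (suc N) a zero _ = ≡⇒≈ (trans (comp-zero (compS a g) h)
    (trans (comp-zero a g) (sym (comp-zero a (compS g h)))))
  comp-assoc g h eg eh (suc N) a (suc n) (s≤s n<N) = begin
    compS (compS a g) h (suc n)
      ≈⟨ comp-suc (compS a g) h n eh ⟩
    mulS (tail h) (compS (tail (compS a g)) h) n
      ≈⟨ mul-congˡ n (tail h) _ (mulS (compS (tail g) h) Z) inner ⟩
    mulS (tail h) (mulS (compS (tail g) h) Z) n
      ≈⟨ mul-assoc (tail h) (compS (tail g) h) Z n ⟨
    mulS (mulS (tail h) (compS (tail g) h)) Z n
      ≈⟨ mul-congʳ n (tail (compS g h)) _ Z (λ k _ → comp-suc g h k eh) ⟨
    mulS (tail (compS g h)) Z n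
      ≈⟨ comp-suc a (compS g h) n (≈-trans (≡⇒≈ (comp-zero g h)) eg) ⟨
    compS a (compS g h) (suc n) ∎
    where
    open ≈-Reasoning
    Z : Series
    Z = compS (tail a) (compS g h)
    inner : ∀ k → k ≤ n → compS (tail (compS a g)) h k ≈ mulS (compS (tail g) h) Z k
    inner k k≤n = begin
      compS (tail (compS a g)) h k
        ≈⟨ comp-congʳ k _ (mulS (tail g) (compS (tail a) g)) h (λ i _ → comp-suc a g i eg) ⟩
      compS (mulS (tail g) (compS (tail a) g)) h k
        ≈⟨ comp-mul h eh (suc k) (tail g) (compS (tail a) g) k ≤-refl ⟩
      mulS (compS (tail g) h) (compS (compS (tail a) g) h) k
        ≈⟨ mul-congˡ k (compS (tail g) h) _ Z
            (λ i i≤k → comp-assoc g h eg eh N (tail a) i (≤-<-trans i≤k (≤-<-trans k≤n n<N))) ⟩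
      mulS (compS (tail g) h) Z k ∎

  comp-idʳ : ∀ n f → compS f idX n ≈ f n
  comp-idʳ zero    f = ≡⇒≈ (comp-zero f idX)
  comp-idʳ (suc n) f = ≈-trans (comp-suc f idX n ≈-refl)
    (≈-trans (mul-congʳ n (tail idX) oneS (compS (tail f) idX) (λ { zero _ → ≈-refl ; (suc _) _ → ≈-refl }))
      (≈-trans (≡⇒≈ (mul-oneˡ (compS (tail f) idX) n)) (comp-idʳ n (tail f))))

  comp-0ˡ : ∀ g n → compS (λ _ → 0) g n ≡ 0
  comp-0ˡ g n = comp-* 0 (λ _ → 0) g n

  comp-oneˡ : ∀ g n → g 0 ≈ 0 → compS oneS g n ≈ oneS n
  comp-oneˡ g zero    e = ≡⇒≈ (comp-zero oneS g)
  comp-oneˡ g (suc n) e = ≈-trans (comp-suc oneS g n e)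
    (mul-≈0ʳ (tail g) (compS (tail oneS) g) n (λ k _ → ≡⇒≈ (comp-0ˡ g k)))

  comp-idˡ : ∀ g n → g 0 ≈ 0 → compS idX g n ≈ g n
  comp-idˡ g zero    e = ≈-trans (≡⇒≈ (comp-zero idX g)) (≈-sym e)
  comp-idˡ g (suc n) e = ≈-trans (comp-suc idX g n e)
    (≈-trans (mul-congˡ n (tail g) (compS (tail idX) g) oneS
      (λ k _ → ≈-trans (comp-congʳ k (tail idX) oneS g (λ { zero _ → ≈-refl ; (suc _) _ → ≈-refl })) (comp-oneˡ g k e)))
      (≡⇒≈ (mul-oneʳ (tail g) n)))

  -- Iterates.

  iter-zero : ∀ f m → f 0 ≈ 0 → iter f m 0 ≈ 0
  iter-zero f zero    e = ≈-refl
  iter-zero f (suc m) e = ≈-trans (≡⇒≈ (comp-zero f (iter f m))) e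

  iter-one : ∀ f n → iter f 1 n ≈ f n
  iter-one f n = comp-idʳ n f

  iter-+ : ∀ f m k n → f 0 ≈ 0 → iter f (m + k) n ≈ compS (iter f m) (iter f k) n
  iter-+ f zero    k n e = ≈-sym (comp-idˡ (iter f k) n (iter-zero f k e))
  iter-+ f (suc m) k n e = ≈-trans
    (comp-congˡ n f (iter f (m + k)) (compS (iter f m) (iter f k)) (λ i → iter-+ f m k i e))
    (≈-sym (comp-assoc (iter f m) (iter f k) (iter-zero f m e) (iter-zero f k e) (suc n) f n ≤-refl))

  iter-* : ∀ f m k n → f 0 ≈ 0 → iter f (m * k) n ≈ iter (iter f k) m n
  iter-* f zero    k n e = ≈-refl
  iter-* f (suc m) k n e = ≈-trans (iter-+ f k (m * k) n e)
    (comp-congˡ n (iter f k) (iter f (m * k)) (iter (iter f k) m) (λ i → iter-* f m k i e))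

  -- Both sides are the iterate of exponent m + 1.
  iter-comm : ∀ f m n → f 0 ≈ 0 → compS (iter f m) f n ≈ compS f (iter f m) n
  iter-comm f m n e = begin
    compS (iter f m) f n            ≈⟨ comp-congˡ n (iter f m) (iter f 1) f (iter-one f) ⟨
    compS (iter f m) (iter f 1) n   ≈⟨ iter-+ f m 1 n e ⟨
    iter f (m + 1) n                ≡⟨ cong (λ z → iter f z n) (+-comm m 1) ⟩
    compS f (iter f m) n            ∎
    where open ≈-Reasoning

  -- Orders of series, and series close to X.

  mul-≈0ˡ : ∀ f g n → (∀ k → k ≤ n → f k ≈ 0) → mulS f g n ≈ 0
  mul-≈0ˡ f g n e = ≈-trans (mul-congʳ n f (λ _ → 0) g e) (≡⇒≈ (mul-zeroˡ g n))

  Order≥ : ℕ → Series → Set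
  Order≥ k h = ∀ n → n < k → h n ≈ 0

  mul-order : ∀ {a b f g} → Order≥ a f → Order≥ b g → Order≥ (a + b) (mulS f g)
  mul-order {a} {b} {f} {g} ef eg n n<a+b with <-≤-connex n a
  ... | inj₁ n<a = mul-≈0ˡ f g n (λ k k≤n → ef k (≤-<-trans k≤n n<a))
  ... | inj₂ a≤n = begin
    mulS f g n                              ≡⟨ cong (mulS f g) (m+[n∸m]≡n a≤n) ⟨
    mulS f g (a + (n ∸ a))                  ≈⟨ mul-shiftˡ f g a (n ∸ a) ef ⟩
    mulS (λ i → f (a + i)) g (n ∸ a)        ≈⟨ mul-≈0ʳ (λ i → f (a + i)) g (n ∸ a) (λ k k≤ → eg k (≤-<-trans k≤ n∸a<b)) ⟩
    0                                       ∎
    where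
    open ≈-Reasoning
    n∸a<b : n ∸ a < b
    n∸a<b = +-cancelˡ-< a (n ∸ a) b (subst (_< a + b) (sym (m+[n∸m]≡n a≤n)) n<a+b)

  mul-leading : ∀ {a b f g} → Order≥ a f → Order≥ b g → mulS f g (a + b) ≈ f a * g b
  mul-leading {a} {b} {f} {g} ef eg = begin
    mulS f g (a + b)                                      ≈⟨ mul-shiftˡ f g a b ef ⟩
    mulS (λ i → f (a + i)) g b                            ≡⟨ cong (mulS (λ i → f (a + i)) g) (+-identityʳ b) ⟨
    mulS (λ i → f (a + i)) g (b + 0)                      ≈⟨ mul-shiftʳ (λ i → f (a + i)) g b 0 eg ⟩
    mulS (λ i → f (a + i)) (λ i → g (b + i)) 0            ≡⟨ mul-zero (λ i → f (a + i)) (λ i → g (b + i)) ⟩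
    f (a + 0) * g (b + 0)                                 ≡⟨ cong₂ (λ x y → f x * g y) (+-identityʳ a) (+-identityʳ b) ⟩
    f a * g b                                             ∎
    where open ≈-Reasoning

  -- g(X) = X (1 + v(X)) with v of order at least r.
  record Tangent (g : Series) (r : ℕ) : Set where
    field
      g₀≈0 : g 0 ≈ 0
      g₁≈1 : g 1 ≈ 1
      gap  : ∀ i → 0 < i → i < r → g (suc i) ≈ 0

  -- The series v = g(X)/X - 1; its constant coefficient is set to 0, which agrees modulo p because
  -- g₁ ≈ 1.
  relativePart : Series → Series
  relativePart g zero    = 0
  relativePart g (suc i) = g (suc (suc i))

  relativePart-order : ∀ {g r} → Tangent g r → Order≥ r (relativePart g)
  relativePart-order t zero    _   = ≈-refl
  relativePart-order t (suc i) i<r = Tangent.gap t (suc i) (s≤s z≤n) i<r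

  tail≈1+relativePart : ∀ {g r} → Tangent g r → ∀ n → tail g n ≈ oneS n + relativePart g n
  tail≈1+relativePart t zero    = Tangent.g₁≈1 t
  tail≈1+relativePart t (suc n) = ≈-refl

  -- Binomial expansion of (1 + v)^j, cut off where v³, of order 3r, begins.
  pow-expansion : ∀ {g r} → Tangent g r → let v = relativePart g in
    ∀ j n → n < r + (r + r) → powS (tail g) j n ≈ oneS n + (j * v n + (j C 2) * mulS v v n)
  pow-expansion t zero    n _ = ≡⇒≈ (sym (+-identityʳ _))
  pow-expansion {g} {r} t (suc j) n n<3r = begin
    mulS (tail g) (powS (tail g) j) n
      ≈⟨ mul-cong n (tail g) (λ k → oneS k + v k) (powS (tail g) j) E
          (λ k _ → tail≈1+relativePart t k) (λ k k≤n → pow-expansion t j k (≤-<-trans k≤n n<3r)) ⟩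
    mulS (λ k → oneS k + v k) E n
      ≡⟨ trans (mul-+ˡ oneS v E n) (cong (_+ mulS v E n) (mul-oneˡ E n)) ⟩
    E n + mulS v E n
      ≡⟨ cong (E n +_) vE ⟩
    E n + (v n + (j * vv n + (j C 2) * mulS v vv n))
      ≈⟨ +-congˡ (E n) (+-congˡ (v n) (+-congˡ (j * vv n) (*-≈0ʳ (j C 2)
          (mul-order {r} {r + r} {v} {vv} v-order (mul-order v-order v-order) n n<3r)))) ⟩
    E n + (v n + (j * vv n + 0))
      ≡⟨ lem (oneS n) (v n) (vv n) j (j C 2) ⟩
    oneS n + (suc j * v n + (j + (j C 2)) * vv n)
      ≡⟨ cong (λ z → oneS n + (suc j * v n + z * vv n)) (trans (pascal j 1) (cong (_+ (j C 2)) (nC1≡n j))) ⟨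
    oneS n + (suc j * v n + (suc j C 2) * vv n) ∎
    where
    open ≈-Reasoning
    v vv E : Series
    v = relativePart g
    vv = mulS v v
    E k = oneS k + (j * v k + (j C 2) * vv k)
    v-order : Order≥ r v
    v-order = relativePart-order t
    vE : mulS v E n ≡ v n + (j * vv n + (j C 2) * mulS v vv n)
    vE = trans (mul-+ʳ v oneS (λ k → j * v k + (j C 2) * vv k) n)
      (cong₂ _+_ (mul-oneʳ v n)
        (trans (mul-+ʳ v (λ k → j * v k) (λ k → (j C 2) * vv k) n)
          (cong₂ _+_ (mul-*ʳ v j v n) (mul-*ʳ v (j C 2) vv n))))
    lem : ∀ o v w j c → o + (j * v + c * w) + (v + (j * w + 0)) ≡ o + (suc j * v + (j + c) * w)
    lem = solve-∀

  pow-at-0 : ∀ {g r} → Tangent g r → ∀ j → powS (tail g) j 0 ≈ 1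
  pow-at-0 t zero = ≈-refl
  pow-at-0 {g} t (suc j) = ≈-trans (≡⇒≈ (mul-zero (tail g) (powS (tail g) j)))
    (*-cong (Tangent.g₁≈1 t) (pow-at-0 t j))

  r≤3r : ∀ r → r ≤ r + (r + r)
  r≤3r r = m≤m+n r (r + r)

  pow-gap : ∀ {g r} → Tangent g r → ∀ j n → 0 < n → n < r → powS (tail g) j n ≈ 0
  pow-gap {g} {r} t j (suc n) _ n<r = ≈-trans (pow-expansion t j (suc n) (<-≤-trans n<r (r≤3r r)))
    (+-≈0 (*-≈0ʳ j (relativePart-order t (suc n) n<r))
      (*-≈0ʳ (j C 2) (mul-order {r} {r} (relativePart-order t) (relativePart-order t) (suc n) (<-≤-trans n<r (m≤m+n r r)))))

  -- Below exponent 2r the square of v is invisible, so (1 + v)^j looks like 1 + j v.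
  pow-leading : ∀ {g r} → Tangent g r → 0 < r → ∀ j m → m < r → powS (tail g) j (r + m) ≈ j * g (suc (r + m))
  pow-leading {g} {r@(suc _)} t _ j m m<r = ≈-trans (pow-expansion t j (r + m) (+-monoʳ-< r (<-≤-trans m<r (m≤m+n r r))))
    (≈-trans (+-congˡ (j * g (suc (r + m))) (*-≈0ʳ (j C 2)
       (mul-order {r} {r} (relativePart-order t) (relativePart-order t) (r + m) (+-monoʳ-< r m<r))))
      (≡⇒≈ (+-identityʳ _)))

  -- Coefficients of h ∘ g for h of given order.

  comp-shift : ∀ g h k n → g 0 ≈ 0 → Order≥ k h
    → compS h g (k + n) ≈ ∑ (suc n) (λ i → h (k + i) * powS (tail g) (k + i) (n ∸ i))
  comp-shift g h k n g₀ low = begin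
    compS h g (k + n)
      ≡⟨ comp≡∑ h g (k + n) ⟩
    ∑ (suc (k + n)) F
      ≡⟨ cong (λ z → ∑ z F) (+-suc k n) ⟨
    ∑ (k + suc n) F
      ≡⟨ ∑-split k (suc n) F ⟩
    ∑ k F + ∑ (suc n) (λ i → F (k + i))
      ≈⟨ +-cong (∑-≈0 k (λ i i<k → *-≈0ˡ (powS g i (k + n)) (low i i<k)))
          (∑-≈ (suc n) (λ i i≤n → *-congˡ (h (k + i)) (≈-trans
            (≡⇒≈ (cong (powS g (k + i)) (split i (s≤s⁻¹ i≤n)))) (pow-tail g (k + i) (n ∸ i) g₀)))) ⟩
    ∑ (suc n) (λ i → h (k + i) * powS (tail g) (k + i) (n ∸ i)) ∎
    where
    open ≈-Reasoning
    F : ℕ → ℕ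
    F j = h j * powS g j (k + n)
    split : ∀ i → i ≤ n → k + n ≡ k + i + (n ∸ i)
    split i i≤n = trans (cong (k +_) (sym (m+[n∸m]≡n i≤n))) (sym (+-assoc k i (n ∸ i)))

  comp-below : ∀ {g r} → Tangent g r → ∀ h k → Order≥ k h → ∀ n → n < k + r → compS h g n ≈ h n
  comp-below {g} {r} t h k low n n<k+r with <-≤-connex n k
  ... | inj₁ n<k = ≈-trans (≡⇒≈ (comp≡∑ h g n)) (≈-trans
    (∑-≈0 (suc n) (λ i i≤n → *-≈0ˡ (powS g i n) (low i (≤-<-trans (s≤s⁻¹ i≤n) n<k)))) (≈-sym (low n n<k)))
  ... | inj₂ k≤n = begin
    compS h g n             ≡⟨ cong (compS h g) (m+[n∸m]≡n k≤n) ⟨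
    compS h g (k + m)       ≈⟨ comp-shift g h k m (Tangent.g₀≈0 t) low ⟩
    ∑ (suc m) F             ≡⟨ ∑-last m F ⟩
    ∑ m F + F m             ≈⟨ +-cong (∑-≈0 m (λ i i<m → *-≈0ʳ (h (k + i))
                                 (pow-gap t (k + i) (m ∸ i) (m<n⇒0<n∸m i<m) (≤-<-trans (m∸n≤m m i) m<r))))
                                 (*-congˡ (h (k + m)) (≈-trans (≡⇒≈ (cong (powS (tail g) (k + m)) (n∸n≡0 m))) (pow-at-0 t (k + m)))) ⟩
    0 + h (k + m) * 1       ≡⟨ *-identityʳ (h (k + m)) ⟩
    h (k + m)               ≡⟨ cong h (m+[n∸m]≡n k≤n) ⟩
    h n                     ∎
    where
    open ≈-Reasoning
    m : ℕ
    m = n ∸ k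
    m<r : m < r
    m<r = +-cancelˡ-< k m r (subst (_< k + r) (sym (m+[n∸m]≡n k≤n)) n<k+r)
    F : ℕ → ℕ
    F i = h (k + i) * powS (tail g) (k + i) (m ∸ i)

  -- In `comp-shift` at r + m, a term i ≤ m meets (tail g)^(k+i) at exponent at least r, the last
  -- term i = r + m meets its constant coefficient 1 and returns h, and the terms between fall into
  -- the gap. The remaining sum is thus the coefficient of h ∘ g - h.
  comp-key : ∀ {g r} → Tangent g r → 0 < r → ∀ h k → Order≥ k h → ∀ m
    → compS h g (k + (r + m)) ≈ ∑ (suc m) (λ i → h (k + i) * powS (tail g) (k + i) (r + (m ∸ i))) + h (k + (r + m))
  comp-key {g} {r@(suc s)} t _ h k low m = begin
    compS h g (k + (r + m))
      ≈⟨ comp-shift g h k (r + m) (Tangent.g₀≈0 t) low ⟩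
    ∑ (suc (r + m)) F
      ≡⟨ cong (λ z → ∑ (suc z) F) (+-comm r m) ⟩
    ∑ (suc m + r) F
      ≡⟨ ∑-split (suc m) r F ⟩
    ∑ (suc m) F + ∑ r (λ i → F (suc m + i))
      ≡⟨ cong (∑ (suc m) F +_) (∑-last s (λ i → F (suc m + i))) ⟩
    ∑ (suc m) F + (∑ s (λ i → F (suc m + i)) + F (suc m + s))
      ≈⟨ +-cong (∑-≈ (suc m) (λ i i≤m → ≡⇒≈ (cong (λ z → h (k + i) * powS (tail g) (k + i) z) (+-∸-assoc r (s≤s⁻¹ i≤m)))))
          (+-cong (∑-≈0 s (λ i i<s → *-≈0ʳ (h (k + (suc m + i))) (≈-trans
              (≡⇒≈ (cong (powS (tail g) (k + (suc m + i))) (rest i)))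
              (pow-gap t (k + (suc m + i)) (s ∸ i) (m<n⇒0<n∸m i<s) (s≤s (m∸n≤m s i))))))
            (*-congˡ (h (k + (suc m + s))) (≈-trans
              (≡⇒≈ (cong (powS (tail g) (k + (suc m + s))) (trans (rest s) (n∸n≡0 s)))) (pow-at-0 t (k + (suc m + s)))))) ⟩
    ∑ (suc m) F′ + (0 + h (k + (suc m + s)) * 1)
      ≡⟨ cong (∑ (suc m) F′ +_) (trans (*-identityʳ (h (k + (suc m + s)))) (cong (λ z → h (k + suc z)) (+-comm m s))) ⟩
    ∑ (suc m) F′ + h (k + (r + m)) ∎
    where
    open ≈-Reasoning
    F F′ : ℕ → ℕ
    F i = h (k + i) * powS (tail g) (k + i) (r + m ∸ i)
    F′ i = h (k + i) * powS (tail g) (k + i) (r + (m ∸ i))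
    rest : ∀ i → r + m ∸ (suc m + i) ≡ s ∸ i
    rest i = trans (cong (_∸ (m + i)) (+-comm s m)) ([m+n]∸[m+o]≡n∸o m s i)

  -- The difference operator Δ on four coefficients.

  Δ : Series → Series → Series
  Δ g h n = compS h g n + neg (h n)

  comp≈id+Δ : ∀ g h n → compS h g n ≈ h n + Δ g h n
  comp≈id+Δ g h n = ≈-sym (begin
    h n + (compS h g n + neg (h n))   ≡⟨ lem (h n) (compS h g n) (neg (h n)) ⟩
    compS h g n + (h n + neg (h n))   ≈⟨ +-congˡ (compS h g n) (neg-inverse (h n)) ⟩
    compS h g n + 0                   ≡⟨ +-identityʳ _ ⟩
    compS h g n                       ∎)
    where
    open ≈-Reasoning
    lem : ∀ a b c → a + (b + c) ≡ b + (a + c)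
    lem = solve-∀

  Δ-unique : ∀ g h n x → compS h g n ≈ x + h n → Δ g h n ≈ x
  Δ-unique g h n x e = +-cancelˡ (h n) (≈-trans (≈-sym (comp≈id+Δ g h n)) (≈-trans e (≡⇒≈ (+-comm x (h n)))))

  nonlinearPart : Series → Series
  nonlinearPart g zero          = 0
  nonlinearPart g (suc zero)    = 0
  nonlinearPart g (suc (suc n)) = g (suc (suc n))

  nonlinearPart-at : ∀ g n → 0 < n → nonlinearPart g (suc n) ≡ g (suc n)
  nonlinearPart-at g (suc n) _ = refl

  nonlinearPart-order : ∀ {g r} → Tangent g r → Order≥ (suc r) (nonlinearPart g)
  nonlinearPart-order t zero          _         = ≈-refl
  nonlinearPart-order t (suc zero)    _         = ≈-refl
  nonlinearPart-order t (suc (suc n)) (s≤s n<r) = Tangent.gap t (suc n) (s≤s z≤n) n<r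

  id+nonlinearPart : ∀ {g r} → Tangent g r → ∀ n → g n ≈ idX n + nonlinearPart g n
  id+nonlinearPart t zero          = Tangent.g₀≈0 t
  id+nonlinearPart t (suc zero)    = Tangent.g₁≈1 t
  id+nonlinearPart t (suc (suc n)) = ≈-refl

  -- Says h = X^k (x₀ + x₁ X + x₂ X² + x₃ X³ + ...) modulo p. Since x₀ may be 0, `k` only bounds the
  -- order from below.
  record Lead (k : ℕ) (h : Series) (x₀ x₁ x₂ x₃ : ℕ) : Set where
    field
      low : Order≥ k h
      at₀ : h (k + 0) ≈ x₀
      at₁ : h (k + 1) ≈ x₁
      at₂ : h (k + 2) ≈ x₂
      at₃ : h (k + 3) ≈ x₃

  -- g(X) = X + X^(r+1) (c₀ + c₁ X + c₂ X² + c₃ X³ + …), and σ is the coefficient of X^(r+3) in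
  -- v² = (g(X)/X − 1)², that is c₀² if r = 3 and 0 if r > 3.
  record Jet (g : Series) (r c₀ c₁ c₂ c₃ σ : ℕ) : Set where
    field
      3≤r     : 3 ≤ r
      tangent : Tangent g r
      coeffs  : Lead (suc r) (nonlinearPart g) c₀ c₁ c₂ c₃
      square  : mulS (relativePart g) (relativePart g) (r + 3) ≈ σ
    open Tangent tangent public

    0<r : 0 < r
    0<r = ≤-trans (s≤s z≤n) 3≤r

    private
      at : ∀ m → m < r → ∀ {c} → nonlinearPart g (suc (r + m)) ≈ c → ∀ j → powS (tail g) j (r + m) ≈ j * c
      at m m<r e j = ≈-trans (pow-leading tangent 0<r j m m<r)
        (*-congˡ j (≈-trans (≡⇒≈ (sym (nonlinearPart-at g (r + m) (<-≤-trans 0<r (m≤m+n r m))))) e))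

    pow₀ : ∀ j → powS (tail g) j (r + 0) ≈ j * c₀
    pow₀ = at 0 0<r (Lead.at₀ coeffs)

    pow₁ : ∀ j → powS (tail g) j (r + 1) ≈ j * c₁
    pow₁ = at 1 (≤-trans (s≤s (s≤s z≤n)) 3≤r) (Lead.at₁ coeffs)

    pow₂ : ∀ j → powS (tail g) j (r + 2) ≈ j * c₂
    pow₂ = at 2 3≤r (Lead.at₂ coeffs)

    -- Among the four exponents only r + 3 can reach 2r, so only here can v² contribute.
    pow₃ : ∀ j → powS (tail g) j (r + 3) ≈ j * c₃ + (j C 2) * σ
    pow₃ j = ≈-trans (pow-expansion tangent j (r + 3) (+-monoʳ-< r (≤-<-trans 3≤r (m<m+n r 0<r))))
      (≈-trans (+-congʳ (j * v (r + 3) + (j C 2) * mulS v v (r + 3)) (≡⇒≈ (oneS-at (r + 3) (<-≤-trans 0<r (m≤m+n r 3)))))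
        (+-cong (*-congˡ j (≈-trans (≡⇒≈ (v-at (r + 3))) (Lead.at₃ coeffs))) (*-congˡ (j C 2) square)))
      where
      v : Series
      v = relativePart g
      oneS-at : ∀ n → 0 < n → oneS n ≡ 0
      oneS-at (suc n) _ = refl
      v-at : ∀ n → v n ≡ nonlinearPart g (suc n)
      v-at zero    = refl
      v-at (suc n) = refl

  Δ-order : ∀ {g r} → Tangent g r → ∀ {h k} → Order≥ k h → Order≥ (k + r) (Δ g h)
  Δ-order {g} t {h} {k} low n n<k+r = Δ-unique g h n 0 (comp-below t h k low n n<k+r)

  -- Linearity and (X^j ∘ g) - X^j = X^j ((1 + v)^j - 1) for j = k, ..., k + 3. By order, `σ` can
  -- meet only x₀.
  Δ-lead : ∀ {g r c₀ c₁ c₂ c₃ σ k h x₀ x₁ x₂ x₃} → Jet g r c₀ c₁ c₂ c₃ σ → Lead k h x₀ x₁ x₂ x₃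
    → Lead (k + r) (Δ g h)
        (x₀ * (k * c₀))
        (x₀ * (k * c₁) + x₁ * ((k + 1) * c₀))
        (x₀ * (k * c₂) + x₁ * ((k + 1) * c₁) + x₂ * ((k + 2) * c₀))
        (x₀ * (k * c₃ + (k C 2) * σ) + x₁ * ((k + 1) * c₂) + x₂ * ((k + 2) * c₁) + x₃ * ((k + 3) * c₀))
  Δ-lead {g} {r} {c₀} {c₁} {c₂} {c₃} {σ} {k} {h} {x₀} {x₁} {x₂} {x₃} J L = record
    { low = Δ-order tangent low
    ; at₀ = value 0 (≈-trans (+-congʳ 0 (first pow₀)) (≡⇒≈ (+-identityʳ _)))
    ; at₁ = value 1 (+-cong (first pow₁) (≈-trans (+-congʳ 0 (*-cong at₁ (pow₀ (k + 1)))) (≡⇒≈ (+-identityʳ _))))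
    ; at₂ = value 2 (≈-trans (+-cong (first pow₂) (+-cong (*-cong at₁ (pow₁ (k + 1)))
        (+-congʳ 0 (*-cong at₂ (pow₀ (k + 2)))))) (≡⇒≈ (assoc₃ (x₀ * (k * c₂)) _ _)))
    ; at₃ = value 3 (≈-trans (+-cong (*-cong at₀ (≈-trans (pow₃ (k + 0)) (≡⇒≈ (cong (λ j → j * c₃ + (j C 2) * σ) (+-identityʳ k)))))
        (+-cong (*-cong at₁ (pow₂ (k + 1))) (+-cong (*-cong at₂ (pow₁ (k + 2)))
        (+-congʳ 0 (*-cong at₃ (pow₀ (k + 3))))))) (≡⇒≈ (assoc₄ (x₀ * (k * c₃ + (k C 2) * σ)) _ _ _)))
    }
    where
    open Jet J
    open Lead L
    value : ∀ m {x} → ∑ (suc m) (λ i → h (k + i) * powS (tail g) (k + i) (r + (m ∸ i))) ≈ x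
      → Δ g h (k + r + m) ≈ x
    value m e = ≈-trans (≡⇒≈ (cong (Δ g h) (+-assoc k r m)))
      (Δ-unique g h (k + (r + m)) _ (≈-trans (comp-key tangent 0<r h k low m) (+-congʳ (h (k + (r + m))) e)))
    first : ∀ {n c} → (∀ j → powS (tail g) j n ≈ j * c) → h (k + 0) * powS (tail g) (k + 0) n ≈ x₀ * (k * c)
    first {n} {c} pow = *-cong at₀ (≈-trans (pow (k + 0)) (≡⇒≈ (cong (_* c) (+-identityʳ k))))
    assoc₃ : ∀ a b c → a + (b + (c + 0)) ≡ a + b + c
    assoc₃ = solve-∀
    assoc₄ : ∀ a b c d → a + (b + (c + (d + 0))) ≡ a + b + c + d
    assoc₄ = solve-∀

  -- Iterated differences, and reading the order of tangency off a test series.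

  Δ^ : ℕ → Series → Series → Series
  Δ^ zero    g y = y
  Δ^ (suc i) g y = Δ g (Δ^ i g y)

  -- T^m = (1 + Δ)^m for the substitution operator T = (– ∘ g).
  comp-iter-binomial : ∀ g y → g 0 ≈ 0 → ∀ m i n
    → compS (Δ^ i g y) (iter g m) n ≈ ∑ (suc m) (λ l → (m C l) * Δ^ (l + i) g y n)
  comp-iter-binomial g y e zero i n = ≈-trans (comp-idʳ n (Δ^ i g y))
    (≡⇒≈ (sym (trans (+-identityʳ _) (*-identityˡ _))))
  comp-iter-binomial g y e (suc m) i n = begin
    compS (d i) (compS g (iter g m)) n
      ≈⟨ comp-assoc g (iter g m) e (iter-zero g m e) (suc n) (d i) n ≤-refl ⟨
    compS (compS (d i) g) (iter g m) n
      -- The innermost T is replaced by 1 + Δ. This calls the induction hypothesis at both `i` and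
      -- `suc i`, hence the general starting index.
      ≈⟨ comp-congʳ n (compS (d i) g) (λ k → d i k + d (suc i) k) (iter g m) (λ k _ → comp≈id+Δ g (d i) k) ⟩
    compS (λ k → d i k + d (suc i) k) (iter g m) n
      ≡⟨ comp-+ (d i) (d (suc i)) (iter g m) n ⟩
    compS (d i) (iter g m) n + compS (d (suc i)) (iter g m) n
      ≈⟨ +-cong (comp-iter-binomial g y e m i n) (comp-iter-binomial g y e m (suc i) n) ⟩
    (1 * d i n + ∑ m F) + ∑ (suc m) (λ l → (m C l) * d (l + suc i) n)
      ≡⟨ cong₂ (λ a b → 1 * d i n + a + b) (sym extend)
          (∑-cong (suc m) (λ l _ → cong (λ z → (m C l) * d z n) (+-suc l i))) ⟩
    (1 * d i n + ∑ (suc m) F) + ∑ (suc m) G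
      ≡⟨ trans (+-assoc (1 * d i n) (∑ (suc m) F) (∑ (suc m) G)) (cong (1 * d i n +_) (+-comm (∑ (suc m) F) (∑ (suc m) G))) ⟩
    1 * d i n + (∑ (suc m) G + ∑ (suc m) F)
      ≡⟨ cong (1 * d i n +_) (trans (sym (∑-+ (suc m) G F)) (∑-cong (suc m) (λ l _ →
          trans (sym (*-distribʳ-+ (d (suc l + i) n) (m C l) (m C suc l))) (cong (_* d (suc l + i) n) (sym (pascal m l)))))) ⟩
    1 * d i n + ∑ (suc m) (λ l → (suc m C suc l) * d (suc l + i) n) ∎
    where
    open ≈-Reasoning
    d : ℕ → Series
    d j = Δ^ j g y
    F G : ℕ → ℕ
    F l = (m C suc l) * d (suc l + i) n
    G l = (m C l) * d (suc l + i) n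
    extend : ∑ (suc m) F ≡ ∑ m F
    extend = trans (∑-last m F) (trans (cong (∑ m F +_) (cong (_* d (suc m + i) n) (k>n⇒nCk≡0 (n<1+n m)))) (+-identityʳ _))

  -- The leading coefficient of `Δ-lead` without a `Jet`: `comp-detect` knows nothing of G but its
  -- tangency, possibly of order below 3.
  Δ-leading : ∀ {g r} → Tangent g r → 0 < r → ∀ {h k} → Order≥ k h → Δ g h (k + r) ≈ h k * (k * g (suc r))
  Δ-leading {g} {r} t 0<r {h} {k} low = ≈-trans (≡⇒≈ (cong (Δ g h) (cong (k +_) (sym (+-identityʳ r)))))
    (Δ-unique g h (k + (r + 0)) _ (≈-trans (comp-key t 0<r h k low 0) (+-congʳ (h (k + (r + 0)))
      (≈-trans (≡⇒≈ (trans (+-identityʳ _) (cong (λ z → h z * powS (tail g) z (r + 0)) (+-identityʳ k))))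
        (*-congˡ (h k) (≈-trans (pow-leading t 0<r k 0 0<r) (≡⇒≈ (cong (λ z → k * g (suc z)) (+-identityʳ r)))))))))

  -- Induction on N: once G is tangent to order N, the coefficient of X^(k+N) in y ∘ G - y is y_k ·
  -- k · G_(N+1). It vanishes, and y_k · k may be cancelled.
  comp-detect : ∀ {G y k} → G 0 ≈ 0 → G 1 ≈ 1 → Order≥ k y → (∀ x → y k * (k * x) ≈ 0 → x ≈ 0)
    → ∀ N → (∀ n → n < k + N → compS y G n ≈ y n) → Tangent G N
  comp-detect G₀ G₁ low reg zero    fix = record { g₀≈0 = G₀ ; g₁≈1 = G₁ ; gap = λ _ _ () }
  comp-detect {G} {y} {k} G₀ G₁ low reg (suc N) fix = record { g₀≈0 = G₀ ; g₁≈1 = G₁ ; gap = gap′ }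
    where
    t : Tangent G N
    t = comp-detect G₀ G₁ low reg N (λ n n<k+N → fix n (<-trans n<k+N (+-monoʳ-< k (n<1+n N))))
    gap′ : ∀ i → 0 < i → i < suc N → G (suc i) ≈ 0
    gap′ i 0<i (s≤s i≤N) with m≤n⇒m<n∨m≡n i≤N
    ... | inj₁ i<N  = Tangent.gap t i 0<i i<N
    ... | inj₂ refl = reg (G (suc N)) (≈-trans (≈-sym (Δ-leading t 0<i low))
      (Δ-unique G y (k + N) 0 (fix (k + N) (+-monoʳ-< k (n<1+n N)))))

  iter-linear : ∀ {g r} → Tangent g r → ∀ m → iter g m 1 ≈ 1
  iter-linear t zero = ≈-refl
  iter-linear {g} t (suc m) = ≈-trans (comp-suc g (iter g m) 0 (iter-zero g m g₀≈0))
    (≈-trans (≡⇒≈ (mul-zero (tail (iter g m)) (compS (tail g) (iter g m))))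
      (*-cong (iter-linear t m) (≈-trans (≡⇒≈ (comp-zero (tail g) (iter g m))) g₁≈1)))
    where open Tangent t

  lead-low : ∀ {K h x} → Lead K h 0 0 0 x → Order≥ (K + 3) h
  lead-low {K} {h} L n n<K+3 with <-≤-connex n K
  ... | inj₁ n<K = Lead.low L n n<K
  ... | inj₂ K≤n = ≈-trans (≡⇒≈ (cong h (sym (m+[n∸m]≡n K≤n))))
    (at (n ∸ K) (+-cancelˡ-< K (n ∸ K) 3 (subst (_< K + 3) (sym (m+[n∸m]≡n K≤n)) n<K+3)))
    where
    at : ∀ i → i < 3 → h (K + i) ≈ 0
    at 0 _ = Lead.at₀ L
    at 1 _ = Lead.at₁ L
    at 2 _ = Lead.at₂ L
    at (suc (suc (suc _))) (s≤s (s≤s (s≤s ())))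

-- A prime p > 3, so that 2, 3 and 6 are invertible.

module ModuloPrime (p : ℕ) (pp : Prime p) (3<p : 3 < p) where

  private
    instance
      p≢0 : NonZero p
      p≢0 = prime⇒nonZero pp

  open Modulo p

  *-≉0 : ∀ {a b} → a ≉ 0 → b ≉ 0 → a * b ≉ 0
  *-≉0 {a} {b} a≉0 b≉0 ab≈0 with euclidsLemma a b pp (≈0⇒∣ ab≈0)
  ... | inj₁ p∣a = a≉0 (∣⇒≈0 p∣a)
  ... | inj₂ p∣b = b≉0 (∣⇒≈0 p∣b)

  *-integral : ∀ {a b} → a ≉ 0 → a * b ≈ 0 → b ≈ 0
  *-integral {a} {b} a≉0 ab≈0 with euclidsLemma a b pp (≈0⇒∣ ab≈0)
  ... | inj₁ p∣a = ⊥-elim (a≉0 (∣⇒≈0 p∣a))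
  ... | inj₂ p∣b = ∣⇒≈0 p∣b

  *-cancelˡ : ∀ {c a b} → c ≉ 0 → c * a ≈ c * b → a ≈ b
  *-cancelˡ {c} {a} {b} c≉0 e = +-cancelʳ (neg b) (≈-trans (*-integral c≉0 (begin
    c * (a + neg b)      ≡⟨ *-distribˡ-+ c a (neg b) ⟩
    c * a + c * neg b    ≈⟨ +-congʳ (c * neg b) e ⟩
    c * b + c * neg b    ≡⟨ *-distribˡ-+ c b (neg b) ⟨
    c * (b + neg b)      ≈⟨ *-≈0ʳ c (neg-inverse b) ⟩
    0                    ∎)) (≈-sym (neg-inverse b)))
    where open ≈-Reasoning

  small≉0 : ∀ n → 0 < n → n < p → n ≉ 0
  small≉0 (suc n) _ n<p e = <⇒≱ n<p (∣⇒≤ (≈0⇒∣ e))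

  2≉0 : 2 ≉ 0
  2≉0 = small≉0 2 (s≤s z≤n) (<-trans (n<1+n 2) 3<p)

  3≉0 : 3 ≉ 0
  3≉0 = small≉0 3 (s≤s z≤n) 3<p

  comp-iter-prime : ∀ g y n → g 0 ≈ 0 → compS y (iter g p) n ≈ y n + Δ^ p g y n
  comp-iter-prime g y n e = begin
    compS y (iter g p) n
      ≈⟨ comp-iter-binomial g y e p 0 n ⟩
    ∑ (suc p) F
      ≈⟨ ends p middle ⟩
    1 * y n + (p C p) * Δ^ (p + 0) g y n
      ≡⟨ cong₂ _+_ (*-identityˡ (y n)) (trans (cong₂ _*_ (nCn≡1 p) (cong (λ i → Δ^ i g y n) (+-identityʳ p))) (*-identityˡ _)) ⟩
    y n + Δ^ p g y n ∎
    where
    open ≈-Reasoning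
    F : ℕ → ℕ
    F l = (p C l) * Δ^ (l + 0) g y n
    middle : ∀ i → 0 < i → i < p → F i ≈ 0
    middle i 0<i i<p = *-≈0ˡ (Δ^ (i + 0) g y n) (∣⇒≈0 (prime∣binomial pp i 0<i i<p))
    ends : ∀ m .{{_ : NonZero m}} {H : ℕ → ℕ} → (∀ i → 0 < i → i < m → H i ≈ 0) → ∑ (suc m) H ≈ H 0 + H m
    ends (suc m) {H} mid = +-congˡ (H 0) (≈-trans (≡⇒≈ (∑-last m (H ∘ suc)))
      (+-congʳ (H (suc m)) (∑-≈0 m (λ i i<m → mid (suc i) (s≤s z≤n) (s≤s i<m)))))

  -- From i(g) to i(g^{∘p}).

  module RamificationStep {g r c₀ c₁ c₂ c₃ σ} (J : Jet g r c₀ c₁ c₂ c₃ σ) (r≈3 : r ≈ 3) (c₀≉0 : c₀ ≉ 0) where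
    open Jet J

    -- The invariant of g is P - Q = 2σc₀² + 2c₀c₁c₂ - c₁³ - c₀²c₃.
    P Q : ℕ
    P = 2 * σ * (c₀ * c₀) + 2 * c₀ * c₁ * c₂
    Q = c₁ * c₁ * c₁ + c₀ * c₀ * c₃

    private
      open ≈-Reasoning

      k K : ℕ
      k = r * pred p
      K = k + r

      K≡r*p : K ≡ r * p
      K≡r*p = trans (+-comm k r) (trans (sym (*-suc r (pred p))) (cong (r *_) (suc-pred p)))

      K≈0 : K ≈ 0
      K≈0 = ≈-trans (≡⇒≈ (trans K≡r*p (*-comm r p))) (p*≈0 r)

      k+3≈0 : k + 3 ≈ 0
      k+3≈0 = ≈-trans (+-congˡ k (≈-sym r≈3)) K≈0

      k≉0 : k ≉ 0
      k≉0 k≈0 = 3≉0 (≈-trans (+-congʳ 3 (≈-sym k≈0)) k+3≈0)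

      -- With k ≡ −3, the coefficients of y are chosen to cancel the second and the third
      -- coefficient of Δ y; its first one dies under the next Δ, because K ≡ 0.
      x₀ x₁ x₂ z : ℕ
      x₀ = 2 * c₀ * c₀
      x₁ = k * c₀ * c₁
      x₂ = 2 * k * c₀ * c₂ + k * (k + 1) * (c₁ * c₁)
      z  = x₀ * (k * c₃ + (k C 2) * σ) + x₁ * ((k + 1) * c₂) + x₂ * ((k + 2) * c₁) + 0 * ((k + 3) * c₀)

      y : Series
      y = shift k λ { 0 → x₀ ; 1 → x₁ ; 2 → x₂ ; _ → 0 }

      y-lead : Lead k y x₀ x₁ x₂ 0
      y-lead = record
        { low = λ n n<k → ≡⇒≈ (shift-low k _ n n<k)
        ; at₀ = ≡⇒≈ (shift-at k _ 0) ; at₁ = ≡⇒≈ (shift-at k _ 1)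
        ; at₂ = ≡⇒≈ (shift-at k _ 2) ; at₃ = ≡⇒≈ (shift-at k _ 3) }

      -- As k + 1 ≡ -2 and k + 2 ≡ -1, solving the two vanishing conditions for x₁/x₀ and x₂/x₀ has
      -- common denominator 2c₀², which is the choice of x₀. With these values both coefficients are
      -- multiples of k + 3.
      Δy-lead : Lead K (Δ g y) (x₀ * (k * c₀)) 0 0 z
      Δy-lead = record
        { low = Lead.low L ; at₀ = Lead.at₀ L
        ; at₁ = ≈-trans (Lead.at₁ L) (≈-trans (≡⇒≈ (lem₁ k c₀ c₁)) (*-≈0ˡ (k * c₀ * c₀ * c₁) k+3≈0))
        ; at₂ = ≈-trans (Lead.at₂ L) (≈-trans (≡⇒≈ (lem₂ k c₀ c₁ c₂)) (*-≈0ˡ _ k+3≈0))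
        ; at₃ = Lead.at₃ L }
        where
        L = Δ-lead J y-lead
        lem₁ : ∀ k c d → 2 * c * c * (k * d) + k * c * d * ((k + 1) * c) ≡ (k + 3) * (k * c * c * d)
        lem₁ = solve-∀
        lem₂ : ∀ k c d e → 2 * c * c * (k * e) + k * c * d * ((k + 1) * d)
          + (2 * k * c * e + k * (k + 1) * (d * d)) * ((k + 2) * c)
          ≡ (k + 3) * (2 * k * c * c * e + k * (k + 1) * c * d * d)
        lem₂ = solve-∀

      -- Evaluation at k ≡ -3: the coefficients 2k of c₀²c₃ and k(k+1)(k+2) of c₁³ become -6, while
      -- 2 · C(k, 2) and A become 12.
      z+6Q≈6P : z + 6 * Q ≈ 6 * P
      z+6Q≈6P = begin
        z + 6 * Q
          ≡⟨ lem k (k C 2) σ c₀ c₁ c₂ c₃ ⟩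
        (k + 3) * (2 * c₀ * c₀ * c₃ + (k * k + 2) * (c₁ * c₁ * c₁)) + (2 * (k C 2) * (σ * (c₀ * c₀)) + A * (c₀ * c₁ * c₂))
          ≈⟨ +-cong (*-≈0ˡ _ k+3≈0) (+-cong (*-congʳ (σ * (c₀ * c₀)) 2t≈12) (*-congʳ (c₀ * c₁ * c₂) A≈12)) ⟩
        12 * (σ * (c₀ * c₀)) + 12 * (c₀ * c₁ * c₂)
          ≡⟨ lem′ σ c₀ c₁ c₂ ⟩
        6 * P ∎
        where
        A : ℕ
        A = k * (k + 1) + 2 * k * (k + 2)
        t : ℕ
        t = k C 2
        2t≈12 : 2 * t ≈ 12
        -- 2t - 12 = (k + 3)(k - 4); adding 4(k + 3) ≡ 0 turns this into an identity without
        -- subtraction. The same is done for `A` below.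
        2t≈12 = +-cancelʳ (4 * (k + 3)) (begin
          2 * t + 4 * (k + 3)         ≡⟨ a₁ t k ⟩
          2 * t + k + (3 * k + 12)    ≡⟨ cong (_+ (3 * k + 12)) (2*nC2+n≡n*n k) ⟩
          k * k + (3 * k + 12)        ≡⟨ a₂ k ⟩
          12 + k * (k + 3)            ≈⟨ +-congˡ 12 (≈-trans (*-≈0ʳ k k+3≈0) (≈-sym (*-≈0ʳ 4 k+3≈0))) ⟩
          12 + 4 * (k + 3)            ∎)
          where
          a₁ : ∀ t k → 2 * t + 4 * (k + 3) ≡ 2 * t + k + (3 * k + 12)
          a₁ = solve-∀
          a₂ : ∀ k → k * k + (3 * k + 12) ≡ 12 + k * (k + 3)
          a₂ = solve-∀
        A≈12 : A ≈ 12
        A≈12 = +-cancelʳ (4 * (k + 3)) (begin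
          A + 4 * (k + 3)             ≡⟨ a₃ k ⟩
          12 + 3 * k * (k + 3)        ≈⟨ +-congˡ 12 (≈-trans (*-≈0ʳ (3 * k) k+3≈0) (≈-sym (*-≈0ʳ 4 k+3≈0))) ⟩
          12 + 4 * (k + 3)            ∎)
          where
          a₃ : ∀ k → k * (k + 1) + 2 * k * (k + 2) + 4 * (k + 3) ≡ 12 + 3 * k * (k + 3)
          a₃ = solve-∀
        lem : ∀ k t s c d e f → 2 * c * c * (k * f + t * s) + k * c * d * ((k + 1) * e)
          + (2 * k * c * e + k * (k + 1) * (d * d)) * ((k + 2) * d) + 0 * ((k + 3) * c) + 6 * (d * d * d + c * c * f)
          ≡ (k + 3) * (2 * c * c * f + (k * k + 2) * (d * d * d))
            + (2 * t * (s * (c * c)) + (k * (k + 1) + 2 * k * (k + 2)) * (c * d * e))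
        lem = solve-∀
        lem′ : ∀ s c d e → 12 * (s * (c * c)) + 12 * (c * d * e) ≡ 6 * (2 * s * (c * c) + 2 * c * d * e)
        lem′ = solve-∀

      -- The first coefficient w enters Δ h only through w K and w C(K, 2). The lemma serves once
      -- with K ≡ 0, and from then on with w = 0.
      Δ-lead-resonant : ∀ {K h w z} → w * K ≈ 0 → w * (K C 2) ≈ 0 → Lead K h w 0 0 z
        → Lead (K + r) (Δ g h) 0 0 0 (z * ((K + 3) * c₀))
      Δ-lead-resonant {K} {h} {w} {z} wK wt L = record
        { low = Lead.low L′
        ; at₀ = ≈-trans (Lead.at₀ L′) (wK* c₀)
        ; at₁ = ≈-trans (Lead.at₁ L′) (≈-trans (≡⇒≈ (+-identityʳ _)) (wK* c₁))
        ; at₂ = ≈-trans (Lead.at₂ L′) (≈-trans (≡⇒≈ (trans (+-identityʳ _) (+-identityʳ _))) (wK* c₂))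
        ; at₃ = ≈-trans (Lead.at₃ L′) (+-congʳ (z * ((K + 3) * c₀)) (≈-trans (≡⇒≈ (lem w K c₃ (K C 2) σ))
            (+-≈0 (*-≈0ˡ c₃ wK) (*-≈0ˡ σ wt)))) }
        where
        L′ = Δ-lead J L
        wK* : ∀ c → w * (K * c) ≈ 0
        wK* c = ≈-trans (≡⇒≈ (sym (*-assoc w K c))) (*-≈0ˡ c wK)
        lem : ∀ w K c t s → w * (K * c + t * s) + 0 + 0 ≡ w * K * c + w * t * s
        lem = solve-∀

      -- What the surviving coefficient has been multiplied by, namely (i+1)! (3c₀)^(i+1) modulo p.
      unit : ℕ → ℕ
      unit zero    = (K + 3) * c₀
      unit (suc i) = unit i * ((K + suc i * r + 3) * c₀)

      K+ir+3≈3[i+1] : ∀ i → K + i * r + 3 ≈ suc i * 3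
      K+ir+3≈3[i+1] i = ≈-trans (+-congʳ 3 (+-cong K≈0 (*-congˡ i r≈3))) (≡⇒≈ (+-comm (i * 3) 3))

      -- The factor is 3(i + 1)c₀ modulo p and would first vanish at i + 1 = p, one step after the
      -- last Δ.
      factor≉0 : ∀ i → suc i < p → (K + i * r + 3) * c₀ ≉ 0
      factor≉0 i i<p = *-≉0 (λ e → *-≉0 (small≉0 (suc i) (s≤s z≤n) i<p) 3≉0 (≈-trans (≈-sym (K+ir+3≈3[i+1] i)) e)) c₀≉0

      unit≉0 : ∀ i → suc i < p → unit i ≉ 0
      unit≉0 zero    i<p = subst (λ m → (m + 3) * c₀ ≉ 0) (+-identityʳ K) (factor≉0 0 i<p)
      unit≉0 (suc i) i<p = *-≉0 (unit≉0 i (<-trans (n<1+n (suc i)) i<p)) (factor≉0 (suc i) i<p)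

      Δ^y-lead : ∀ i → Lead (K + suc i * r) (Δ^ (suc (suc i)) g y) 0 0 0 (z * unit i)
      Δ^y-lead zero = subst (λ m → Lead (K + m) (Δ^ 2 g y) 0 0 0 (z * unit 0)) (sym (+-identityʳ r))
        (Δ-lead-resonant (*-≈0ʳ w K≈0) (*-≈0ʳ w KC2≈0) Δy-lead)
        where
        w : ℕ
        w = x₀ * (k * c₀)
        KC2≈0 : K C 2 ≈ 0
        KC2≈0 = *-integral 2≉0 (+-cancelʳ K (≈-trans (≡⇒≈ (2*nC2+n≡n*n K)) (≈-trans (*-≈0ʳ K K≈0) (≈-sym K≈0))))
      Δ^y-lead (suc i) = subst (λ m → Lead m (Δ^ (suc (suc (suc i))) g y) 0 0 0 (z * unit (suc i)))
        (trans (+-assoc K (suc i * r) r) (cong (K +_) (+-comm (suc i * r) r)))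
        (subst (λ x → Lead (K + suc i * r + r) (Δ^ (suc (suc (suc i))) g y) 0 0 0 x) (*-assoc z (unit i) _)
          (Δ-lead-resonant ≈-refl ≈-refl (Δ^y-lead i)))

      u : ℕ
      -- `unit i` belongs to Δ^(i+2), since the first Δ only produces `z`.
      u = unit (p ∸ 2)

      2+[p∸2]≡p : 2 + (p ∸ 2) ≡ p
      2+[p∸2]≡p = m+[n∸m]≡n (≤-trans (s≤s (s≤s z≤n)) 3<p)

      Δ^p-lead : Lead (k + r * p) (Δ^ p g y) 0 0 0 (z * u)
      Δ^p-lead = subst₂ (λ m i → Lead m (Δ^ i g y) 0 0 0 (z * u))
        (trans (+-assoc k r _) (cong (k +_) (trans (cong (_* r) 2+[p∸2]≡p) (*-comm p r)))) 2+[p∸2]≡p (Δ^y-lead (p ∸ 2))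

      u≉0 : u ≉ 0
      u≉0 = unit≉0 (p ∸ 2) (≤-reflexive 2+[p∸2]≡p)

      N : ℕ
      N = r * p + 3

      G : Series
      G = iter g p

      fixed : ∀ n → n < k + N → compS y G n ≈ y n
      fixed n n<k+N = ≈-trans (comp-iter-prime g y n g₀≈0) (≈-trans (+-congˡ (y n)
        (lead-low Δ^p-lead n (subst (n <_) (sym (+-assoc k (r * p) 3)) n<k+N))) (≡⇒≈ (+-identityʳ (y n))))

      yk≈x₀ : y k ≈ x₀
      yk≈x₀ = ≈-trans (≡⇒≈ (cong y (sym (+-identityʳ k)))) (Lead.at₀ y-lead)

      regular : ∀ x → y k * (k * x) ≈ 0 → x ≈ 0
      regular x e = *-integral k≉0 (*-integral (*-≉0 (*-≉0 2≉0 c₀≉0) c₀≉0) (≈-trans (≈-sym (*-congʳ (k * x) yk≈x₀)) e))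

    -- Holds whatever the invariant is: y ∘ G - y = Δ^p y starts no earlier than X^(k+rp+3). The
    -- next coefficient of G decides whether i(G) is exactly rp + 3.
    tangent-iter : Tangent (iter g p) (r * p + 3)
    tangent-iter = comp-detect (iter-zero g p g₀≈0) (iter-linear tangent p) (Lead.low y-lead) regular N fixed

    private
      -- The coefficient of X^(k+N) in y ∘ G - y, computed once from G and once from Δ^p y.
      leading : y k * (k * G (suc N)) ≈ z * u
      leading = ≈-trans (≈-sym (Δ-leading tangent-iter (≤-trans (s≤s z≤n) (m≤n+m 3 (r * p))) (Lead.low y-lead)))
        (Δ-unique G y (k + N) (z * u) (≈-trans (comp-iter-prime g y (k + N) g₀≈0)
          (≈-trans (+-congˡ (y (k + N)) (≈-trans (≡⇒≈ (cong (Δ^ p g y) (sym (+-assoc k (r * p) 3)))) (Lead.at₃ Δ^p-lead)))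
            (≡⇒≈ (+-comm (y (k + N)) (z * u))))))

      6≉0 : 6 ≉ 0
      6≉0 = *-≉0 {2} {3} 2≉0 3≉0

    ramified⇒P≉Q : iter g p (suc (r * p + 3)) ≉ 0 → P ≉ Q
    ramified⇒P≉Q ram P≈Q = ram (regular _ (≈-trans leading (*-≈0ˡ {z} u
      (+-cancelʳ (6 * Q) {z} {0} (≈-trans z+6Q≈6P (*-congˡ 6 P≈Q))))))

    P≉Q⇒ramified : P ≉ Q → iter g p (suc (r * p + 3)) ≉ 0
    P≉Q⇒ramified P≉Q e = *-≉0 (λ z≈0 → P≉Q (*-cancelˡ 6≉0 (≈-trans (≈-sym z+6Q≈6P) (+-congʳ (6 * Q) {z} {0} z≈0)))) u≉0
      (≈-trans (≈-sym leading) (*-≈0ʳ (y k) (*-≈0ʳ k e)))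

  -- Coefficients of a series commuting with f.

  module Commuting {f g a₁ a₂ a₃ a₄ r c₀ c₁ c₂ c₃}
    (Jf : Jet f 3 a₁ a₂ a₃ a₄ (a₁ * a₁)) (Jg : Jet g r c₀ c₁ c₂ c₃ 0)
    (comm : ∀ n → compS g f n ≈ compS f g n) (r≈3 : r ≈ 3) (a₁≉0 : a₁ ≉ 0) (c₀≉0 : c₀ ≉ 0) where
    private
      open ≈-Reasoning
      module F = Jet Jf
      module G = Jet Jg

      f̂ ĝ : Series
      f̂ = nonlinearPart f
      ĝ = nonlinearPart g

      substitute : ∀ {g h r} → Tangent g r → g 0 ≈ 0 → h 0 ≈ 0 → ∀ n
        → compS g h n ≈ h n + (nonlinearPart g n + Δ h (nonlinearPart g) n)
      substitute {g} {h} t g₀ h₀ n = begin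
        compS g h n
          ≈⟨ comp-congʳ n g (λ k → idX k + nonlinearPart g k) h (λ k _ → id+nonlinearPart t k) ⟩
        compS (λ k → idX k + nonlinearPart g k) h n
          ≡⟨ comp-+ idX (nonlinearPart g) h n ⟩
        compS idX h n + compS (nonlinearPart g) h n
          ≈⟨ +-cong (comp-idˡ h n h₀) (comp≈id+Δ h (nonlinearPart g) n) ⟩
        h n + (nonlinearPart g n + Δ h (nonlinearPart g) n) ∎

      -- Both compositions contain X + f̂ + ĝ; cancelling it leaves the two differences.
      Δ-comm : ∀ n → Δ f ĝ n ≈ Δ g f̂ n
      Δ-comm n = +-cancelˡ (idX n + f̂ n + ĝ n) (begin
        idX n + f̂ n + ĝ n + Δ f ĝ n        ≡⟨ +-assoc (idX n + f̂ n) (ĝ n) _ ⟩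
        idX n + f̂ n + (ĝ n + Δ f ĝ n)      ≈⟨ +-congʳ (ĝ n + Δ f ĝ n) (id+nonlinearPart F.tangent n) ⟨
        f n + (ĝ n + Δ f ĝ n)              ≈⟨ substitute G.tangent G.g₀≈0 F.g₀≈0 n ⟨
        compS g f n                        ≈⟨ comm n ⟩
        compS f g n                        ≈⟨ substitute F.tangent F.g₀≈0 G.g₀≈0 n ⟩
        g n + (f̂ n + Δ g f̂ n)              ≈⟨ +-congʳ (f̂ n + Δ g f̂ n) (id+nonlinearPart G.tangent n) ⟩
        idX n + ĝ n + (f̂ n + Δ g f̂ n)      ≡⟨ lem (idX n) (ĝ n) (f̂ n) (Δ g f̂ n) ⟩
        idX n + f̂ n + ĝ n + Δ g f̂ n        ∎)
        where
        lem : ∀ a b c d → a + b + (c + d) ≡ a + c + b + d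
        lem = solve-∀

      R : ℕ
      R = suc r

      R≈4 : R ≈ 4
      R≈4 = +-congˡ 1 r≈3

      RC2≈6 : R C 2 ≈ 6
      RC2≈6 = *-cancelˡ 2≉0 (+-cancelʳ 4 (begin
        2 * (R C 2) + 4    ≈⟨ +-congˡ (2 * (R C 2)) R≈4 ⟨
        2 * (R C 2) + R    ≡⟨ 2*nC2+n≡n*n R ⟩
        R * R              ≈⟨ *-cong R≈4 R≈4 ⟩
        16                 ∎))

      Lf = Δ-lead Jf G.coeffs
      Lg = Δ-lead Jg F.coeffs

      -- `R + 3 + m` and `4 + r + m` are both r + 4 + m. At m = 0 both sides are 4a₁c₀, so
      -- information begins at m = 1.
      compare : ∀ m {x y} → Δ f ĝ (R + 3 + m) ≈ x → Δ g f̂ (4 + r + m) ≈ y → x ≈ y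
      compare m {x} {y} ex ey = begin
        x                     ≈⟨ ex ⟨
        Δ f ĝ (R + 3 + m)     ≈⟨ Δ-comm (R + 3 + m) ⟩
        Δ g f̂ (R + 3 + m)     ≡⟨ cong (λ z → Δ g f̂ (suc z + m)) (+-comm r 3) ⟩
        Δ g f̂ (4 + r + m)     ≈⟨ ey ⟩
        y                     ∎

      at-4 : ∀ x i c → x * ((R + i) * c) ≈ x * ((4 + i) * c)
      at-4 x i c = *-congˡ x (*-congʳ c (+-congʳ i R≈4))

      at-4₀ : ∀ x c → x * (R * c) ≈ x * (4 * c)
      at-4₀ x c = *-congˡ x (*-congʳ c R≈4)

    a₁c₁≈a₂c₀ : a₁ * c₁ ≈ a₂ * c₀
    a₁c₁≈a₂c₀ = +-cancelˡ (4 * a₂ * c₀ + 4 * a₁ * c₁) (begin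
      4 * a₂ * c₀ + 4 * a₁ * c₁ + a₁ * c₁         ≡⟨ lem₁ a₁ a₂ c₀ c₁ ⟩
      c₀ * (4 * a₂) + c₁ * (5 * a₁)               ≈⟨ +-cong (at-4₀ c₀ a₂) (at-4 c₁ 1 a₁) ⟨
      c₀ * (R * a₂) + c₁ * ((R + 1) * a₁)         ≈⟨ compare 1 (Lead.at₁ Lf) (Lead.at₁ Lg) ⟩
      a₁ * (4 * c₁) + a₂ * (5 * c₀)               ≡⟨ lem₂ a₁ a₂ c₀ c₁ ⟩
      4 * a₂ * c₀ + 4 * a₁ * c₁ + a₂ * c₀         ∎)
      where
      lem₁ : ∀ a b c d → 4 * b * c + 4 * a * d + a * d ≡ c * (4 * b) + d * (5 * a)
      lem₁ = solve-∀
      lem₂ : ∀ a b c d → a * (4 * d) + b * (5 * c) ≡ 4 * b * c + 4 * a * d + b * c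
      lem₂ = solve-∀

    -- At m = 2 the terms 5a₂c₁ agree, leaving 2a₁c₂ ≡ 2a₃c₀.
    a₁c₂≈a₃c₀ : a₁ * c₂ ≈ a₃ * c₀
    a₁c₂≈a₃c₀ = *-cancelˡ 2≉0 (+-cancelˡ (4 * a₃ * c₀ + 5 * c₁ * a₂ + 4 * a₁ * c₂) (begin
      4 * a₃ * c₀ + 5 * c₁ * a₂ + 4 * a₁ * c₂ + 2 * (a₁ * c₂)           ≡⟨ lem₁ a₁ a₂ a₃ c₀ c₁ c₂ ⟩
      c₀ * (4 * a₃) + c₁ * (5 * a₂) + c₂ * (6 * a₁)
        ≈⟨ +-cong (+-cong (at-4₀ c₀ a₃) (at-4 c₁ 1 a₂)) (at-4 c₂ 2 a₁) ⟨
      c₀ * (R * a₃) + c₁ * ((R + 1) * a₂) + c₂ * ((R + 2) * a₁)         ≈⟨ compare 2 (Lead.at₂ Lf) (Lead.at₂ Lg) ⟩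
      a₁ * (4 * c₂) + a₂ * (5 * c₁) + a₃ * (6 * c₀)                     ≡⟨ lem₂ a₁ a₂ a₃ c₀ c₁ c₂ ⟩
      4 * a₃ * c₀ + 5 * c₁ * a₂ + 4 * a₁ * c₂ + 2 * (a₃ * c₀)           ∎))
      where
      lem₁ : ∀ a b e c d g → 4 * e * c + 5 * d * b + 4 * a * g + 2 * (a * g) ≡ c * (4 * e) + d * (5 * b) + g * (6 * a)
      lem₁ = solve-∀
      lem₂ : ∀ a b e c d g → a * (4 * g) + b * (5 * d) + e * (6 * c) ≡ 4 * e * c + 5 * d * b + 4 * a * g + 2 * (e * c)
      lem₂ = solve-∀

    private
      a₂c₂≈a₃c₁ : a₂ * c₂ ≈ a₃ * c₁
      a₂c₂≈a₃c₁ = *-cancelˡ a₁≉0 (begin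
        a₁ * (a₂ * c₂)     ≡⟨ swap a₁ a₂ c₂ ⟩
        a₂ * (a₁ * c₂)     ≈⟨ *-congˡ a₂ a₁c₂≈a₃c₀ ⟩
        a₂ * (a₃ * c₀)     ≡⟨ swap a₂ a₃ c₀ ⟩
        a₃ * (a₂ * c₀)     ≈⟨ *-congˡ a₃ a₁c₁≈a₂c₀ ⟨
        a₃ * (a₁ * c₁)     ≡⟨ swap a₃ a₁ c₁ ⟩
        a₁ * (a₃ * c₁)     ∎)
        where
        swap : ∀ a b c → a * (b * c) ≡ b * (a * c)
        swap = solve-∀

    -- At m = 3 the square term of f contributes C(R, 2)a₁²c₀ ≡ 6a₁²c₀, and g has no counterpart.
    -- After a₂c₂ ≡ a₃c₁ a common factor 3 remains.
    2a₁²c₀+a₁c₃≈a₄c₀ : 2 * a₁ * a₁ * c₀ + a₁ * c₃ ≈ a₄ * c₀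
    2a₁²c₀+a₁c₃≈a₄c₀ = *-cancelˡ 3≉0 (+-cancelˡ (rest + a₃ * c₁) (begin
      rest + a₃ * c₁ + 3 * (2 * a₁ * a₁ * c₀ + a₁ * c₃)
        ≈⟨ +-congʳ (3 * (2 * a₁ * a₁ * c₀ + a₁ * c₃)) (+-congˡ rest a₂c₂≈a₃c₁) ⟨
      rest + a₂ * c₂ + 3 * (2 * a₁ * a₁ * c₀ + a₁ * c₃)
        ≡⟨ lem₁ a₁ a₂ a₃ a₄ c₀ c₁ c₂ c₃ ⟩
      c₀ * (4 * a₄ + 6 * (a₁ * a₁)) + c₁ * (5 * a₃) + c₂ * (6 * a₂) + c₃ * (7 * a₁)
        ≈⟨ +-cong (+-cong (+-cong (*-congˡ c₀ (+-cong (*-congʳ a₄ R≈4) (*-congʳ (a₁ * a₁) RC2≈6)))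
            (at-4 c₁ 1 a₃)) (at-4 c₂ 2 a₂)) (at-4 c₃ 3 a₁) ⟨
      c₀ * (R * a₄ + (R C 2) * (a₁ * a₁)) + c₁ * ((R + 1) * a₃) + c₂ * ((R + 2) * a₂) + c₃ * ((R + 3) * a₁)
        ≈⟨ compare 3 (Lead.at₃ Lf) (Lead.at₃ Lg) ⟩
      a₁ * (4 * c₃ + 0) + a₂ * (5 * c₂) + a₃ * (6 * c₁) + a₄ * (7 * c₀)
        ≡⟨ lem₂ a₁ a₂ a₃ a₄ c₀ c₁ c₂ c₃ ⟩
      rest + a₃ * c₁ + 3 * (a₄ * c₀) ∎))
      where
      rest : ℕ
      rest = 4 * a₄ * c₀ + 5 * a₃ * c₁ + 5 * a₂ * c₂ + 4 * a₁ * c₃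
      lem₁ : ∀ a b e h c d g i → 4 * h * c + 5 * e * d + 5 * b * g + 4 * a * i + b * g + 3 * (2 * a * a * c + a * i)
        ≡ c * (4 * h + 6 * (a * a)) + d * (5 * e) + g * (6 * b) + i * (7 * a)
      lem₁ = solve-∀
      lem₂ : ∀ a b e h c d g i → a * (4 * i + 0) + b * (5 * g) + e * (6 * d) + h * (7 * c)
        ≡ 4 * h * c + 5 * e * d + 5 * b * g + 4 * a * i + e * d + 3 * (h * c)
      lem₂ = solve-∀

    -- The relations give a₁³(P′ - Q′) ≡ c₀³(P - Q), where P′ and Q′ belong to g. The term `extra` =
    -- 2a₁⁴c₀³ is the share that c₃ contributes through 2a₁²c₀.
    P≉Q-transfer : 2 * (a₁ * a₁) * (a₁ * a₁) + 2 * a₁ * a₂ * a₃ ≉ a₂ * a₂ * a₂ + a₁ * a₁ * a₄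
      → 2 * 0 * (c₀ * c₀) + 2 * c₀ * c₁ * c₂ ≉ c₁ * c₁ * c₁ + c₀ * c₀ * c₃
    P≉Q-transfer P≉Q P′≈Q′ = P≉Q (*-cancelˡ (*-≉0 (*-≉0 c₀≉0 c₀≉0) c₀≉0) (begin
      c₀ * c₀ * c₀ * (2 * (a₁ * a₁) * (a₁ * a₁) + 2 * a₁ * a₂ * a₃)
        ≡⟨ lem₁ a₁ a₂ a₃ c₀ ⟩
      2 * a₁ * c₀ * ((a₂ * c₀) * (a₃ * c₀)) + extra
        ≈⟨ +-congʳ extra (*-congˡ (2 * a₁ * c₀) (*-cong a₁c₁≈a₂c₀ a₁c₂≈a₃c₀)) ⟨
      2 * a₁ * c₀ * ((a₁ * c₁) * (a₁ * c₂)) + extra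
        ≡⟨ lem₂ a₁ c₀ c₁ c₂ ⟩
      a₁ * a₁ * a₁ * (2 * 0 * (c₀ * c₀) + 2 * c₀ * c₁ * c₂) + extra
        ≈⟨ +-congʳ extra (*-congˡ (a₁ * a₁ * a₁) P′≈Q′) ⟩
      a₁ * a₁ * a₁ * (c₁ * c₁ * c₁ + c₀ * c₀ * c₃) + extra
        ≡⟨ lem₃ a₁ c₀ c₁ c₃ ⟩
      (a₁ * c₁) * (a₁ * c₁) * (a₁ * c₁) + a₁ * c₀ * (a₁ * c₀) * (2 * a₁ * a₁ * c₀ + a₁ * c₃)
        ≈⟨ +-cong (*-cong (*-cong a₁c₁≈a₂c₀ a₁c₁≈a₂c₀) a₁c₁≈a₂c₀) (*-congˡ (a₁ * c₀ * (a₁ * c₀)) 2a₁²c₀+a₁c₃≈a₄c₀) ⟩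
      (a₂ * c₀) * (a₂ * c₀) * (a₂ * c₀) + a₁ * c₀ * (a₁ * c₀) * (a₄ * c₀)
        ≡⟨ lem₄ a₁ a₂ a₄ c₀ ⟩
      c₀ * c₀ * c₀ * (a₂ * a₂ * a₂ + a₁ * a₁ * a₄) ∎))
      where
      extra : ℕ
      extra = 2 * (a₁ * a₁) * (a₁ * a₁) * (c₀ * c₀ * c₀)
      lem₁ : ∀ a b e c → c * c * c * (2 * (a * a) * (a * a) + 2 * a * b * e)
        ≡ 2 * a * c * ((b * c) * (e * c)) + 2 * (a * a) * (a * a) * (c * c * c)
      lem₁ = solve-∀
      lem₂ : ∀ a c d g → 2 * a * c * ((a * d) * (a * g)) + 2 * (a * a) * (a * a) * (c * c * c)
        ≡ a * a * a * (2 * 0 * (c * c) + 2 * c * d * g) + 2 * (a * a) * (a * a) * (c * c * c)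
      lem₂ = solve-∀
      lem₃ : ∀ a c d i → a * a * a * (d * d * d + c * c * i) + 2 * (a * a) * (a * a) * (c * c * c)
        ≡ (a * d) * (a * d) * (a * d) + a * c * (a * c) * (2 * a * a * c + a * i)
      lem₃ = solve-∀
      lem₄ : ∀ a b h c → (b * c) * (b * c) * (b * c) + a * c * (a * c) * (h * c) ≡ c * c * c * (b * b * b + a * a * h)
      lem₄ = solve-∀

  -- The series f and its iterates of exponent p^n.

  fOf-jet : ∀ a → Jet (fOf a) 3 (a 1) (a 2) (a 3) (a 4) (a 1 * a 1)
  fOf-jet a = record
    { 3≤r     = ≤-refl
    ; tangent = t
    ; coeffs  = record { low = nonlinearPart-order t ; at₀ = ≈-refl ; at₁ = ≈-refl ; at₂ = ≈-refl ; at₃ = ≈-refl }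
    ; square  = mul-leading (relativePart-order t) (relativePart-order t) }
    where
    t : Tangent (fOf a) 3
    t = record { g₀≈0 = ≈-refl ; g₁≈1 = ≈-refl ; gap = λ
      { 1 _ _ → ≈-refl ; 2 _ _ → ≈-refl ; (suc (suc (suc _))) _ (s≤s (s≤s (s≤s ()))) } }

  tangent⇒jet : ∀ {g r} → 3 < r → Tangent g r → let ĝ = nonlinearPart g in
    Jet g r (ĝ (suc r + 0)) (ĝ (suc r + 1)) (ĝ (suc r + 2)) (ĝ (suc r + 3)) 0
  tangent⇒jet {g} {r} 3<r t = record
    { 3≤r     = <⇒≤ 3<r
    ; tangent = t
    ; coeffs  = record { low = nonlinearPart-order t ; at₀ = ≈-refl ; at₁ = ≈-refl ; at₂ = ≈-refl ; at₃ = ≈-refl }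
    ; square  = mul-order {r} {r} (relativePart-order t) (relativePart-order t) (r + 3) (+-monoʳ-< r 3<r) }

  Ramified : Series → ℕ → Set
  Ramified g r = Tangent g r × g (suc r) ≉ 0

  ramified⇒ramNum : ∀ {g r} → 0 < r → Ramified g r → RamNum p g r
  ramified⇒ramNum {g} {suc r} _ (t , top) =
    (λ { zero _ → unmod g₀≈0 ; (suc zero) _ → unmod g₁≈1 ; (suc (suc k)) (s≤s k<r) → unmod (gap (suc k) (s≤s z≤n) k<r) })
    , (λ e → top (mod e))
    where open Tangent t

  ramNum⇒top : ∀ {g r} → RamNum p g (suc r) → g (suc (suc r)) ≉ 0
  ramNum⇒top (_ , top) e = top (unmod e)

  -- Horner form of the sum; tripled, it is the map r ↦ r p + 3 of the ramification step.
  geomSum-suc : ∀ n → geomSum p (suc n) ≡ geomSum p n * p + 1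
  geomSum-suc zero    = lem p
    where lem : ∀ p → 1 + p * 1 ≡ 1 * p + 1
          lem = solve-∀
  geomSum-suc (suc n) = trans (cong (_+ p ^ suc (suc n)) (geomSum-suc n)) (lem (geomSum p n) p (p ^ n))
    where lem : ∀ s p q → s * p + 1 + p * (p * q) ≡ (s + p * q) * p + 1
          lem = solve-∀

  3*geomSum-suc : ∀ n → 3 * geomSum p (suc n) ≡ 3 * geomSum p n * p + 3
  3*geomSum-suc n = trans (cong (3 *_) (geomSum-suc n)) (lem (geomSum p n) p)
    where lem : ∀ s p → 3 * (s * p + 1) ≡ 3 * s * p + 3
          lem = solve-∀

  3*geomSum≈3 : ∀ n → 3 * geomSum p n ≈ 3
  3*geomSum≈3 zero    = ≈-refl
  3*geomSum≈3 (suc n) = ≈-trans (≡⇒≈ (trans (3*geomSum-suc n) (cong (_+ 3) (*-comm (3 * geomSum p n) p))))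
    (+-congʳ 3 (p*≈0 (3 * geomSum p n)))

  3≤3*geomSum : ∀ n → 3 ≤ 3 * geomSum p n
  3≤3*geomSum zero    = ≤-refl
  3≤3*geomSum (suc n) = subst (3 ≤_) (sym (3*geomSum-suc n)) (m≤n+m 3 (3 * geomSum p n * p))

  3<3*geomSum-suc : ∀ n → 3 < 3 * geomSum p (suc n)
  3<3*geomSum-suc n = subst (3 <_) (sym (3*geomSum-suc n))
    (+-monoˡ-≤ 3 (*-mono-≤ (≤-trans (s≤s z≤n) (3≤3*geomSum n)) (<-trans (s≤s z≤n) 3<p)))

  module _ (a : ℕ → ℕ) (a₁≉0 : a 1 ≉ 0) where
    private
      f : Series
      f = fOf a

      module Base = RamificationStep (fOf-jet a) ≈-refl a₁≉0

      transport : ∀ {g h r s} → (∀ n → g n ≈ h n) → r ≡ s → Ramified h r → Ramified g s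
      transport e refl (t , top) = record
        { g₀≈0 = ≈-trans (e 0) g₀≈0 ; g₁≈1 = ≈-trans (e 1) g₁≈1
        ; gap = λ i 0<i i<r → ≈-trans (e (suc i)) (gap i 0<i i<r) } , λ z → top (≈-trans (≈-sym (e _)) z)
        where open Tangent t

      iter-p^1 : ∀ n → iter f (p ^ 1) n ≈ iter f p n
      iter-p^1 n = ≡⇒≈ (cong (λ m → iter f m n) (*-identityʳ p))

    ramified⇒P≉Q : iter f (p ^ 1) (suc (3 * geomSum p 1)) ≉ 0 → Base.P ≉ Base.Q
    ramified⇒P≉Q top = Base.ramified⇒P≉Q λ e → top (≈-trans (iter-p^1 _)
      (≈-trans (≡⇒≈ (cong (λ r → iter f p (suc r)) (3*geomSum-suc 0))) e))

    -- For n = 1 the step is applied to f, with r = 3 and σ = a₁². From n = 2 on it is applied to an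
    -- iterate with r > 3 and σ = 0, whose invariant is compared with that of f by `Commuting`.
    iter-ramified : Base.P ≉ Base.Q → ∀ n → Ramified (iter f (p ^ n)) (3 * geomSum p n)
    iter-ramified P≉Q zero = transport (iter-one f) refl (Jet.tangent (fOf-jet a) , a₁≉0)
    iter-ramified P≉Q (suc zero) = transport iter-p^1 (sym (3*geomSum-suc 0)) (Base.tangent-iter , Base.P≉Q⇒ramified P≉Q)
    iter-ramified P≉Q (suc (suc n)) with iter-ramified P≉Q (suc n)
    ... | t , top = transport (λ k → iter-* f p (p ^ suc n) k ≈-refl) (sym (3*geomSum-suc (suc n)))
      (Step.tangent-iter , Step.P≉Q⇒ramified (Commuting.P≉Q-transfer (fOf-jet a) J
        (λ k → iter-comm f (p ^ suc n) k ≈-refl) (3*geomSum≈3 (suc n)) a₁≉0 c₀≉0 P≉Q))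
      where
      g : Series
      g = iter f (p ^ suc n)
      r : ℕ
      r = 3 * geomSum p (suc n)
      J = tangent⇒jet (3<3*geomSum-suc n) t
      c₀≉0 : nonlinearPart g (suc (r + 0)) ≉ 0
      c₀≉0 e = top (≈-trans (≡⇒≈ (trans (sym (nonlinearPart-at g r (≤-trans (s≤s z≤n) (3≤3*geomSum (suc n)))))
        (cong (λ m → nonlinearPart g (suc m)) (sym (+-identityʳ r))))) e)
      module Step = RamificationStep J (3*geomSum≈3 (suc n)) c₀≉0

theorem1 : (p : ℕ) → Prime p → 3 < p → (a : ℕ → ℕ)
    → (∀ m → m ≥ 1 → ¬ SeriesEq p (iter (fOf a) m) idX)
    → (∀ n → RamNum p (iter (fOf a) (p ^ n)) (3 * geomSum p n))
    ⇔ ((¬ ModEq p (a 1) 0)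
    × (¬ ModEq p (2 * a 1 ^ 4 + 2 * a 1 * a 2 * a 3) (a 2 ^ 3 + a 1 ^ 2 * a 4)))
theorem1 p pp 3<p a _ = mk⇔ to from
  where
  open ModuloPrime p pp 3<p
  instance
    _ : NonZero p
    _ = prime⇒nonZero pp
  open Modulo p

  P≡ : ∀ x y z → 2 * (x * (x * (x * (x * 1)))) + 2 * x * y * z ≡ 2 * (x * x) * (x * x) + 2 * x * y * z
  P≡ = solve-∀
  Q≡ : ∀ x y z → y * (y * (y * 1)) + x * (x * 1) * z ≡ y * y * y + x * x * z
  Q≡ = solve-∀

  to : (∀ n → RamNum p (iter (fOf a) (p ^ n)) (3 * geomSum p n))
    → (¬ ModEq p (a 1) 0) × (¬ ModEq p (2 * a 1 ^ 4 + 2 * a 1 * a 2 * a 3) (a 2 ^ 3 + a 1 ^ 2 * a 4))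
  -- The case n = 0 yields a₁ ≢ 0, the case n = 1 the invariant.
  to ram = (λ e → a₁≉0 (mod e)) , λ e → ramified⇒P≉Q a a₁≉0 (ramNum⇒top (ram 1))
    (≈-trans (≡⇒≈ (sym (P≡ (a 1) (a 2) (a 3)))) (≈-trans (mod e) (≡⇒≈ (Q≡ (a 1) (a 2) (a 4)))))
    where
    a₁≉0 : a 1 ≉ 0
    a₁≉0 e = ramNum⇒top (ram 0) (≈-trans (iter-one (fOf a) 4) e)

  from : (¬ ModEq p (a 1) 0) × (¬ ModEq p (2 * a 1 ^ 4 + 2 * a 1 * a 2 * a 3) (a 2 ^ 3 + a 1 ^ 2 * a 4))
    → ∀ n → RamNum p (iter (fOf a) (p ^ n)) (3 * geomSum p n)
  from (a₁ , inv) n = ramified⇒ramNum (≤-trans (s≤s z≤n) (3≤3*geomSum n))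
    (iter-ramified a (λ e → a₁ (unmod e)) (λ e → inv (unmod
      (≈-trans (≡⇒≈ (P≡ (a 1) (a 2) (a 3))) (≈-trans e (≡⇒≈ (sym (Q≡ (a 1) (a 2) (a 4)))))))) n)
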